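{- For each $k\in\{3,4,5\}$ there exists $N_0$ such that $\mathcal{B}(k,n)=\binom{k}{2}-1$ for all integers $n\ge N_0$.
   Context: An orthogonal array $\mathrm{OA}(k,n)$ on an alphabet $\Lambda$ with $|\Lambda|=n$ is an $n^2\times k$ matrix $A=(a_{r\ell})$ with entries in $\Lambda$ such that in every pair of distinct columns each ordered pair in $\Lambda^2$ occurs in exactly one row. For distinct columns $c,i,j\in\{1,\dots,k\}$ and $s\in\Lambda$, let $\rho_s(c,i,j)$ be the permutation of $\Lambda$ mapping $a_{ri}\mapsto a_{rj}$ for all rows $r$ with $a_{rc}=s$. With $\pi(\gamma)\in\mathbb{Z}_2$ denoting the parity of a permutation $\gamma$ ($0$ for even, $1$ for odd), define $\tau^c_{ij}(A)=\sum_{s\in\Lambda}\pi(\rho_s(c,i,j))\in\mathbb{Z}_2$. The $\tau$-parity of $A$ is the vector $(\tau^c_{ij}(A))$ indexed by the $k(k-1)(k-2)$ ordered triples $(c,i,j)$ of distinct elements of $\{1,\dots,k\}$. $\mathcal{B}(k,n)$ denotes $\log_2$ of the number of different $\tau$-parities achieved by orthogonal arrays $\mathrm{OA}(k,n)$ (on a fixed alphabet of size $n$). -}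

module Defs where

import Algebra.Properties.CommutativeMonoid.Sum as Sum
open import Data.Fin.Base using (Fin)
open import Data.Fin.Permutation using (Permutation′; permutation; _⟨$⟩ʳ_)
open import Data.Fin.Properties using (_<?_)
open import Data.List.Base using (allFin; cartesianProduct; filter; length)
open import Data.Nat.Base using (ℕ; _*_; _^_; parity)
open import Data.Parity.Base using (Parity)
import Data.Parity.Properties as Parity
open import Data.Product using (Σ-syntax; ∃-syntax; ∃!; _×_; _,_; proj₁; proj₂)
open import Function.Bundles using (Bijection)
open import Level using (0ℓ)
open import Relation.Binary.Bundles using (Setoid)
import Relation.Binary.Construct.On as On
open import Relation.Binary.PropositionalEquality
  using (_≡_; _≢_; refl; trans; cong; setoid; _→-setoid_)
open import Relation.Nullary.Decidable using (_×-dec_)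

open Sum Parity.+-0-commutativeMonoid using (sum)

-- The fixed alphabet Λ of size n is Fin n; the n² rows are indexed by Fin (n * n).
record OA (k n : ℕ) : Set where
  field
    entry      : Fin (n * n) → Fin k → Fin n
    orthogonal : ∀ {i j} → i ≢ j → ∀ x y →
                 ∃! _≡_ λ r → entry r i ≡ x × entry r j ≡ y

inversions : ∀ {n} → Permutation′ n → ℕ
inversions {n} γ =
  length (filter (λ (x , y) → (x <? y) ×-dec ((γ ⟨$⟩ʳ y) <? (γ ⟨$⟩ʳ x)))
                 (cartesianProduct (allFin n) (allFin n)))

π : ∀ {n} → Permutation′ n → Parity
π γ = parity (inversions γ)

module _ {k n : ℕ} (A : OA k n) where
  open OA A

  rowAt : ∀ {i j} → i ≢ j → Fin n → Fin n → Fin (n * n)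
  rowAt i≢j x y = proj₁ (orthogonal i≢j x y)

  ρ-to : ∀ {c i} → c ≢ i → (j : Fin k) → Fin n → Fin n → Fin n
  ρ-to c≢i j s x = entry (rowAt c≢i s x) j

  ρ-to-maps : ∀ {c i} (c≢i : c ≢ i) j s r → entry r c ≡ s →
              ρ-to c≢i j s (entry r i) ≡ entry r j
  ρ-to-maps c≢i j s r eq =
    cong (λ r′ → entry r′ j)
         (proj₂ (proj₂ (orthogonal c≢i s _)) (eq , refl))

  ρ-to-inverse : ∀ {c i j} (c≢i : c ≢ i) (c≢j : c ≢ j) s x →
                 ρ-to c≢j i s (ρ-to c≢i j s x) ≡ x
  ρ-to-inverse {i = i} c≢i c≢j s x =
    let r , (rc≡s , ri≡x) , _ = orthogonal c≢i s x
    in trans (ρ-to-maps c≢j i s r rc≡s) ri≡x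

  ρ : ∀ {c i j} → c ≢ i → c ≢ j → Fin n → Permutation′ n
  ρ {c} {i} {j} c≢i c≢j s = permutation
    (ρ-to c≢i j s)
    (ρ-to c≢j i s)
    (ρ-to-inverse c≢j c≢i s)
    (ρ-to-inverse c≢i c≢j s)

  -- The defining property of ρ_s(c,i,j).
  ρ-maps : ∀ {c i j} (c≢i : c ≢ i) (c≢j : c ≢ j) s r → entry r c ≡ s →
           ρ c≢i c≢j s ⟨$⟩ʳ entry r i ≡ entry r j
  ρ-maps {j = j} c≢i c≢j = ρ-to-maps c≢i j

-- Proofs of _≢_ are definitionally irrelevant, so a Triple is determined by (c,i,j).
record Triple (k : ℕ) : Set where
  field
    c i j : Fin k
    c≢i   : c ≢ i
    c≢j   : c ≢ j
    i≢j   : i ≢ j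

τ : ∀ {k n} → OA k n → Triple k → Parity
τ A t = sum (λ s → π (ρ A c≢i c≢j s))
  where open Triple t

-- The set of vectors that are the τ-parity of some OA(k,n). Two elements are
-- equal when the vectors agree in every coordinate, whichever arrays achieve them.
τ-Parities : ℕ → ℕ → Setoid 0ℓ 0ℓ
τ-Parities k n = record
  { Carrier       = Σ[ v ∈ (Triple k → Parity) ] ∃[ A ] (∀ t → τ {k} {n} A t ≡ v t)
  ; isEquivalence = On.isEquivalence proj₁ (Setoid.isEquivalence (Triple k →-setoid Parity))
  }

HasCardinality : Setoid 0ℓ 0ℓ → ℕ → Set
HasCardinality S m = Bijection (setoid (Fin m)) S

-- "log₂ of the number of τ-parities of OA(k,n)s equals b", i.e. that number is
-- exactly 2 ^ b (no rounding of the logarithm).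
𝓑[_,_]≡_ : ℕ → ℕ → ℕ → Set
𝓑[ k , n ]≡ b = HasCardinality (τ-Parities k n) (2 ^ b)

{-# OPTIONS --safe #-}

-- For an array A, listing the entries of columns c and i turns the rows into the cells of an
-- n × n square; let φ(c,i) be the sign of this bijection. Then τ^c_ij = φ(c,i) + φ(c,j), and
-- φ(i,c) − φ(c,i) is the sign of the transposition of the square, hence independent of A.
-- So τ depends only on the k C 2 values φ(c,i) with c < i, modulo a common constant.
--
-- All these values occur: replacing a subarray by another one on the same symbols changes τ by
-- the difference of the τ-parities of the two subarrays, and there are pairs of linear arrays
-- over Z₇ whose difference is a change of a single φ(c,i). An array of any large order n with
-- ten disjoint subarrays of order 7 comes from Wilson's construction with n = t m + 7 w, where
-- t and w are prime to 6 and m ∈ {4, 19}: arrays with five columns exist for the orders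
-- 4, 5 and 19, 20 = 4 · 5, and linear arrays with six columns for the orders t and w.

module Submission where

open import Defs
open import Data.Nat using (ℕ; _∸_; _≥_)
open import Data.Nat.Combinatorics using (_C_)
open import Data.Product using (∃-syntax; _,_)
open import Data.Sum using (_⊎_; inj₁; inj₂)
open import Relation.Binary.PropositionalEquality using (_≡_; refl)

-- Only differences of τ-parities are evaluated; the τ-parity of a Wilson array stays unknown. The
-- arrays differ only in their ten subarrays, so their parities form a translate of the space of all
-- changes, and an arbitrary array of the same order is matched by comparing its φ with that of one
-- fixed member of the family. The sign of the transposed square depends on n alone and cancels in
-- this comparison, so it is never computed either.
--
-- Truncation uses up one column of the outer array, which is why order t needs six. Both t and w
-- are odd, so t m + 7 w has the parity opposite to m: odd n uses m = 4 and even n uses m = 19.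

-- Signs of permutations as sums over Z₂.

module Signs where

  import Algebra.Properties.CommutativeMonoid.Sum as Sum
  open import Data.Bool.Base using (Bool; true; false; _∧_)
  open import Data.Empty using (⊥-elim)
  open import Data.Fin.Base using (Fin; zero; suc; toℕ; _↑ˡ_; _↑ʳ_; combine; remQuot)
  open import Data.Fin.Permutation using (Permutation′; _⟨$⟩ʳ_; _⟨$⟩ˡ_; _∘ₚ_; inverseˡ; transpose)
  open import Data.Fin.Permutation.Transposition.List
    using (TranspositionList; eval; decompose; eval-decompose)
  import Data.Fin.Permutation.Components as PC
  import Data.Fin.Properties as Fin
  open import Data.Fin.Properties using (_≟_; _<?_; any?)
  open import Data.List.Base using ([]; _∷_; map; tabulate; cartesianProduct; filter; length)
  open import Data.List.Properties using (filter-++; length-++)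
  open import Data.Nat.Base as ℕ using (ℕ; zero; suc; parity; _<ᵇ_)
  open import Data.Parity.Base using (Parity; 0ℙ; 1ℙ; _+_; _*_; _⁻¹)
  import Data.Parity.Properties as ℙ
  open import Data.Product.Base using (_×_; _,_; proj₁; proj₂)
  open import Function.Base using (_∘_; id)
  open import Level using (0ℓ)
  open import Relation.Binary.PropositionalEquality
  open import Relation.Nullary using (Dec; yes; no; does)
  open import Relation.Nullary.Decidable using (_×-dec_; dec-true; dec-false)
  open import Relation.Unary using (Pred; Decidable)
  open Sum ℙ.+-0-commutativeMonoid
    using (sum; sum-cong-≗; ∑-distrib-+; sum-permute; sum-replicate-zero)

  𝟙 : Bool → Parity
  𝟙 true  = 1ℙ
  𝟙 false = 0ℙ

  -- The decision `x <? y` computes to this comparison, so `π≡sgn` needs no conversion between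
  -- orders.
  lt : ∀ {n} → Fin n → Fin n → Parity
  lt x y = 𝟙 (toℕ x <ᵇ toℕ y)

  -- Inversions modulo 2, for arbitrary self-maps, so that composites need not be repackaged as
  -- permutations; only for bijections is this the sign.
  sgn : ∀ {n} → (Fin n → Fin n) → Parity
  sgn f = sum λ x → sum λ y → lt x y * lt (f y) (f x)

  sgn-cong : ∀ {n} {f g : Fin n → Fin n} → f ≗ g → sgn f ≡ sgn g
  sgn-cong f≗g = sum-cong-≗ λ x → sum-cong-≗ λ y →
    cong₂ (λ u v → lt x y * lt u v) (f≗g y) (f≗g x)

  private
    parity-filter-map : ∀ {A : Set} {P : Pred A 0ℓ} (P? : Decidable P) →
      ∀ {m} {B : Set} (g : B → A) (h : Fin m → B) →
      parity (length (filter P? (map g (tabulate h)))) ≡ sum (λ j → 𝟙 (does (P? (g (h j)))))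
    parity-filter-map P? {zero}  g h = refl
    parity-filter-map P? {suc m} g h with does (P? (g (h zero)))
    ... | false = parity-filter-map P? g (h ∘ suc)
    ... | true  = trans (sym (trans (cong _⁻¹ (sym (ℙ.suc-homo-⁻¹ l))) (ℙ.⁻¹-involutive (parity (suc l)))))
                        (cong _⁻¹ (parity-filter-map P? g (h ∘ suc)))
      where l = length (filter P? (map g (tabulate (h ∘ suc))))

    parity-filter : ∀ {A B : Set} {P : Pred (A × B) 0ℓ} (P? : Decidable P) →
      ∀ {m n} (g : Fin m → A) (h : Fin n → B) →
      parity (length (filter P? (cartesianProduct (tabulate g) (tabulate h)))) ≡
      sum (λ i → sum λ j → 𝟙 (does (P? (g i , h j))))
    parity-filter P? {zero}  g h = refl
    parity-filter P? {suc m} g h =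
      trans (cong (parity ∘ length) (filter-++ P? xs ys))
     (trans (cong parity (length-++ (filter P? xs)))
     (trans (ℙ.+-homo-+ (length (filter P? xs)) _)
            (cong₂ _+_ (parity-filter-map P? (g zero ,_) h) (parity-filter P? (g ∘ suc) h))))
      where
        xs = map (g zero ,_) (tabulate h)
        ys = cartesianProduct (tabulate (g ∘ suc)) (tabulate h)

    𝟙-∧ : ∀ a b → 𝟙 (a ∧ b) ≡ 𝟙 a * 𝟙 b
    𝟙-∧ true  b = refl
    𝟙-∧ false b = refl

  π≡sgn : ∀ {n} (γ : Permutation′ n) → π γ ≡ sgn (γ ⟨$⟩ʳ_)
  π≡sgn {n} γ = trans
    (parity-filter (λ (x , y) → (x <? y) ×-dec ((γ ⟨$⟩ʳ y) <? (γ ⟨$⟩ʳ x))) id id)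
    (sum-cong-≗ {n} λ x → sum-cong-≗ {n} λ y →
      𝟙-∧ (toℕ x <ᵇ toℕ y) (toℕ (γ ⟨$⟩ʳ y) <ᵇ toℕ (γ ⟨$⟩ʳ x)))

  private
    <ᵇ-irrefl : ∀ m → (m <ᵇ m) ≡ false
    <ᵇ-irrefl zero    = refl
    <ᵇ-irrefl (suc m) = <ᵇ-irrefl m

    <ᵇ-flip : ∀ m n → m ≢ n → 𝟙 (n <ᵇ m) ≡ 𝟙 (m <ᵇ n) ⁻¹
    <ᵇ-flip zero    zero    m≢n = ⊥-elim (m≢n refl)
    <ᵇ-flip zero    (suc n) m≢n = refl
    <ᵇ-flip (suc m) zero    m≢n = refl
    <ᵇ-flip (suc m) (suc n) m≢n = <ᵇ-flip m n (m≢n ∘ cong suc)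

  lt-irrefl : ∀ {n} (x : Fin n) → lt x x ≡ 0ℙ
  lt-irrefl x = cong 𝟙 (<ᵇ-irrefl (toℕ x))

  lt-flip : ∀ {n} {x y : Fin n} → x ≢ y → lt y x ≡ lt x y ⁻¹
  lt-flip x≢y = <ᵇ-flip _ _ (x≢y ∘ Fin.toℕ-injective)

  -- In characteristic 2 the terms at (x, y) and (y, x) cancel.
  sum-symmetric : ∀ {n} (t : Fin n → Fin n → Parity) →
    (∀ x → t x x ≡ 0ℙ) → (∀ x y → t x y ≡ t y x) → sum (λ x → sum (t x)) ≡ 0ℙ
  sum-symmetric {zero}  t diag symm = refl
  sum-symmetric {suc n} t diag symm = begin
    (t zero zero + r) + sum (λ x → t (suc x) zero + s x)
      ≡⟨ cong₂ _+_ (cong (_+ r) (diag zero)) (∑-distrib-+ {n} (λ x → t (suc x) zero) s) ⟩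
    r + (sum (λ x → t (suc x) zero) + sum s)
      ≡⟨ cong (r +_) (cong₂ _+_ (sum-cong-≗ {n} λ x → symm (suc x) zero)
                       (sum-symmetric (λ x y → t (suc x) (suc y)) (diag ∘ suc) λ x y → symm (suc x) (suc y))) ⟩
    r + (r + 0ℙ)
      ≡⟨ cong (r +_) (ℙ.+-identityʳ r) ⟩
    r + r
      ≡⟨ ℙ.p+p≡0ℙ r ⟩
    0ℙ ∎
    where
      open ≡-Reasoning
      r = sum (λ y → t zero (suc y))
      s = λ x → sum (λ y → t (suc x) (suc y))

  +-≡0⇒≡ : ∀ {p q} → p + q ≡ 0ℙ → p ≡ q
  +-≡0⇒≡ {0ℙ} {0ℙ} _ = refl
  +-≡0⇒≡ {1ℙ} {1ℙ} _ = refl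

  private
    -- Here a, b, c record the order of a pair before, between and after two permutations.
    -- Exchanging the two points complements all three, and the inversion count of `sgn-∘` does not
    -- notice.
    cocycle-symmetric : ∀ a b c →
      (a * c ⁻¹) + ((a * b ⁻¹) + (b * c ⁻¹)) ≡ (a ⁻¹ * c) + ((a ⁻¹ * b) + (b ⁻¹ * c))
    cocycle-symmetric 0ℙ 0ℙ 0ℙ = refl
    cocycle-symmetric 0ℙ 0ℙ 1ℙ = refl
    cocycle-symmetric 0ℙ 1ℙ 0ℙ = refl
    cocycle-symmetric 0ℙ 1ℙ 1ℙ = refl
    cocycle-symmetric 1ℙ 0ℙ 0ℙ = refl
    cocycle-symmetric 1ℙ 0ℙ 1ℙ = refl
    cocycle-symmetric 1ℙ 1ℙ 0ℙ = refl
    cocycle-symmetric 1ℙ 1ℙ 1ℙ = refl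

  module _ {n : ℕ} where

    ⟨$⟩ʳ-injective : (γ : Permutation′ n) → ∀ {x y} → γ ⟨$⟩ʳ x ≡ γ ⟨$⟩ʳ y → x ≡ y
    ⟨$⟩ʳ-injective γ {x} {y} eq = trans (sym (inverseˡ γ)) (trans (cong (γ ⟨$⟩ˡ_) eq) (inverseˡ γ))

    -- For a pair {x , y}, the three inversion indicators of δ, of γ at the image
    -- under δ, and of the composite add up to an even number.
    sgn-∘ : (δ γ : Permutation′ n) → sgn (λ x → γ ⟨$⟩ʳ (δ ⟨$⟩ʳ x)) ≡ sgn (δ ⟨$⟩ʳ_) + sgn (γ ⟨$⟩ʳ_)
    sgn-∘ δ γ = +-≡0⇒≡ (begin
      sgn (g ∘ f) + (sgn f + sgn g)
        ≡⟨ cong (λ z → sgn (g ∘ f) + (sgn f + z)) reindex ⟩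
      sgn (g ∘ f) + (sgn f + ∑∑ λ x y → lt (f x) (f y) * lt (g (f y)) (g (f x)))
        ≡⟨ cong (sgn (g ∘ f) +_) (∑∑-+ _ _) ⟨
      sgn (g ∘ f) + ∑∑ (λ x y → (lt x y * lt (f y) (f x)) + (lt (f x) (f y) * lt (g (f y)) (g (f x))))
        ≡⟨ ∑∑-+ _ _ ⟨
      ∑∑ t
        ≡⟨ sum-symmetric t t-diag t-sym ⟩
      0ℙ ∎)
      where
        open ≡-Reasoning
        f = δ ⟨$⟩ʳ_
        g = γ ⟨$⟩ʳ_
        ∑∑ : (Fin n → Fin n → Parity) → Parity
        ∑∑ s = sum λ x → sum (s x)
        ∑∑-+ : ∀ s r → ∑∑ (λ x y → s x y + r x y) ≡ ∑∑ s + ∑∑ r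
        ∑∑-+ s r = trans (sum-cong-≗ {n} λ x → ∑-distrib-+ {n} (s x) (r x)) (∑-distrib-+ {n} (λ x → sum (s x)) (λ x → sum (r x)))
        reindex : sgn g ≡ ∑∑ λ x y → lt (f x) (f y) * lt (g (f y)) (g (f x))
        reindex = trans (sum-permute {n} {n} (λ u → sum λ v → lt u v * lt (g v) (g u)) δ)
          (sum-cong-≗ {n} λ x → sum-permute {n} {n} (λ v → lt (f x) v * lt (g v) (g (f x))) δ)
        t : Fin n → Fin n → Parity
        t x y = (lt x y * lt (g (f y)) (g (f x)))
              + ((lt x y * lt (f y) (f x)) + (lt (f x) (f y) * lt (g (f y)) (g (f x))))
        t-diag : ∀ x → t x x ≡ 0ℙ
        t-diag x rewrite lt-irrefl x | lt-irrefl (f x) = refl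
        t-sym : ∀ x y → t x y ≡ t y x
        t-sym x y with x ≟ y
        ... | yes refl = refl
        ... | no x≢y
          rewrite lt-flip x≢y | lt-flip (x≢y ∘ ⟨$⟩ʳ-injective δ)
                | lt-flip (x≢y ∘ ⟨$⟩ʳ-injective δ ∘ ⟨$⟩ʳ-injective γ)
          = cocycle-symmetric (lt x y) (lt (f x) (f y)) (lt (g (f x)) (g (f y)))

  sgn-id : ∀ {n} → sgn {n} id ≡ 0ℙ
  sgn-id {n} = trans (sum-cong-≗ {n} λ x → trans (sum-cong-≗ {n} λ y → asym x y) (sum-replicate-zero n)) (sum-replicate-zero n)
    where
      asym : ∀ x y → lt {n} x y * lt y x ≡ 0ℙ
      asym x y with x ≟ y
      ... | yes refl rewrite lt-irrefl x = refl
      ... | no x≢y rewrite lt-flip x≢y = ℙ.p*p⁻¹≡0ℙ (lt x y)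

  sum-split : ∀ m {n} (f : Fin (m ℕ.+ n) → Parity) →
    sum f ≡ sum (λ i → f (i ↑ˡ n)) + sum (λ j → f (m ↑ʳ j))
  sum-split zero    f = refl
  sum-split (suc m) f = trans (cong (f zero +_) (sum-split m (f ∘ suc))) (sym (ℙ.+-assoc (f zero) _ _))

  private
    <ᵇ-+ : ∀ k m n → (k ℕ.+ m <ᵇ k ℕ.+ n) ≡ (m <ᵇ n)
    <ᵇ-+ zero    m n = refl
    <ᵇ-+ (suc k) m n = <ᵇ-+ k m n

    lt-↑ˡ : ∀ {m} n (x y : Fin m) → lt (x ↑ˡ n) (y ↑ˡ n) ≡ lt x y
    lt-↑ˡ n x y = cong₂ (λ a b → 𝟙 (a <ᵇ b)) (Fin.toℕ-↑ˡ x n) (Fin.toℕ-↑ˡ y n)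

    lt-↑ʳ : ∀ m {n} (x y : Fin n) → lt (m ↑ʳ x) (m ↑ʳ y) ≡ lt x y
    lt-↑ʳ m x y rewrite Fin.toℕ-↑ʳ m x | Fin.toℕ-↑ʳ m y = cong 𝟙 (<ᵇ-+ m (toℕ x) (toℕ y))

    lt-↑ʳ-↑ˡ : ∀ {m n} (x : Fin m) (y : Fin n) → lt (m ↑ʳ y) (x ↑ˡ n) ≡ 0ℙ
    lt-↑ʳ-↑ˡ zero    y = refl
    lt-↑ʳ-↑ˡ (suc x) y = lt-↑ʳ-↑ˡ x y

  -- The map preserves both blocks, and hence the order of any two points in different blocks: no
  -- inversion straddles them.
  sgn-split : ∀ {m n} (f : Fin (m ℕ.+ n) → Fin (m ℕ.+ n)) (σ : Fin m → Fin m) (ρ : Fin n → Fin n) →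
    (∀ x → f (x ↑ˡ n) ≡ σ x ↑ˡ n) → (∀ y → f (m ↑ʳ y) ≡ m ↑ʳ ρ y) → sgn f ≡ sgn σ + sgn ρ
  sgn-split {m} {n} f σ ρ fσ fρ = trans (sum-split m _) (cong₂ _+_
    (sum-cong-≗ {m} λ x → trans (sum-split m _) (trans (cong₂ _+_
       (sum-cong-≗ {m} λ y → cong₂ _*_ (lt-↑ˡ n x y) (trans (cong₂ lt (fσ y) (fσ x)) (lt-↑ˡ n (σ y) (σ x))))
       (trans (sum-cong-≗ {n} λ y → trans (cong (lt (x ↑ˡ n) (m ↑ʳ y) *_)
                 (trans (cong₂ lt (fρ y) (fσ x)) (lt-↑ʳ-↑ˡ (σ x) (ρ y)))) (ℙ.*-zeroʳ (lt (x ↑ˡ n) (m ↑ʳ y))))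
              (sum-replicate-zero n)))
       (ℙ.+-identityʳ _)))
    (sum-cong-≗ {n} λ x → trans (sum-split m _) (cong₂ _+_
       (trans (sum-cong-≗ {m} λ y → cong (_* lt (f (y ↑ˡ n)) (f (m ↑ʳ x))) (lt-↑ʳ-↑ˡ y x)) (sum-replicate-zero m))
       (sum-cong-≗ {n} λ y → cong₂ _*_ (lt-↑ʳ m x y) (trans (cong₂ lt (fρ y) (fρ x)) (lt-↑ʳ m (ρ y) (ρ x))))))) 

  -- `combine` lists the cells line by line, so `sgn-split` peels off one line at a time. This turns
  -- the sum over s in the definition of τ into a single sign.
  sgn-blocks : ∀ {m n} (f : Fin (m ℕ.* n) → Fin (m ℕ.* n)) (σ : Fin m → Fin n → Fin n) →
    (∀ s x → f (combine s x) ≡ combine s (σ s x)) → sgn f ≡ sum (λ s → sgn (σ s))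
  sgn-blocks {zero}  f σ fσ = refl
  sgn-blocks {suc m} {n} f σ fσ = trans
    (sgn-split {n} {m ℕ.* n} f (σ zero) rest (fσ zero) f-rest)
    (cong (sgn (σ zero) +_) (sgn-blocks rest (σ ∘ suc) λ s x →
      cong (λ (s , x) → combine s (σ (suc s) x)) (Fin.remQuot-combine s x)))
    where
      rest : Fin (m ℕ.* n) → Fin (m ℕ.* n)
      rest z = let s , x = remQuot {m} n z in combine s (σ (suc s) x)
      f-rest : ∀ z → f (n ↑ʳ z) ≡ n ↑ʳ rest z
      f-rest z = trans (cong (f ∘ (n ↑ʳ_)) (sym (Fin.combine-remQuot {m} n z)))
                       (fσ (suc (proj₁ (remQuot {m} n z))) (proj₂ (remQuot {m} n z)))

  module _ {n : ℕ} where

    transpose-matchˡ : (i j : Fin n) → PC.transpose i j i ≡ j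
    transpose-matchˡ i j rewrite dec-true (i ≟ i) refl = refl

    transpose-matchʳ : (i j : Fin n) → PC.transpose i j j ≡ i
    transpose-matchʳ i j with j ≟ i
    ... | yes j≡i = j≡i
    ... | no _ rewrite dec-true (j ≟ j) refl = refl

    transpose-other : (i j : Fin n) {k : Fin n} → k ≢ i → k ≢ j → PC.transpose i j k ≡ k
    transpose-other i j {k} k≢i k≢j rewrite dec-false (k ≟ i) k≢i | dec-false (k ≟ j) k≢j = refl

    transpose-same : (i k : Fin n) → PC.transpose i i k ≡ k
    transpose-same i k with k ≟ i
    ... | yes k≡i = sym k≡i
    ... | no k≢i rewrite dec-false (k ≟ i) k≢i = refl

    transpose-comm : (i j k : Fin n) → PC.transpose i j k ≡ PC.transpose j i k
    transpose-comm i j k = cases (k ≟ i) (k ≟ j)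
      where
        cases : Dec (k ≡ i) → Dec (k ≡ j) → PC.transpose i j k ≡ PC.transpose j i k
        cases (yes refl) _          = trans (transpose-matchˡ k j) (sym (transpose-matchʳ j k))
        cases (no _)     (yes refl) = trans (transpose-matchʳ i k) (sym (transpose-matchˡ k i))
        cases (no k≢i)   (no k≢j)   = trans (transpose-other i j k≢i k≢j) (sym (transpose-other j i k≢j k≢i))

  sgn-transpose₀₁ : ∀ {n} → sgn (transpose {suc (suc n)} zero (suc zero) ⟨$⟩ʳ_) ≡ 1ℙ
  sgn-transpose₀₁ {n} = trans
    (sgn-split {2} {n} (PC.transpose zero (suc zero)) (PC.transpose zero (suc zero)) id
       (λ { zero → refl ; (suc zero) → refl }) (λ _ → refl))
    (cong (1ℙ +_) (sgn-id {n}))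

  -- δ conjugates the transposition (0 1) to (i j).
  sgn-transpose-≢ : ∀ {n} {i j : Fin n} → i ≢ j → sgn (transpose i j ⟨$⟩ʳ_) ≡ 1ℙ
  sgn-transpose-≢ {suc zero} {zero} {zero} i≢j = ⊥-elim (i≢j refl)
  sgn-transpose-≢ {suc (suc n)} {i} {j} i≢j = trans
    (ℙ.+-cancelˡ-≡ (sgn (δ ⟨$⟩ʳ_)) (sgn (transpose i j ⟨$⟩ʳ_)) (sgn (transpose {suc (suc n)} zero (suc zero) ⟨$⟩ʳ_)) (begin
      sgn (δ ⟨$⟩ʳ_) + sgn (transpose i j ⟨$⟩ʳ_)  ≡⟨ sgn-∘ δ (transpose i j) ⟨
      sgn (PC.transpose i j ∘ δ′)                  ≡⟨ sgn-cong {f = PC.transpose i j ∘ δ′} conj ⟩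
      sgn (δ′ ∘ PC.transpose zero (suc zero))      ≡⟨ sgn-∘ (transpose zero (suc zero)) δ ⟩
      sgn (transpose {suc (suc n)} zero (suc zero) ⟨$⟩ʳ_) + sgn (δ ⟨$⟩ʳ_) ≡⟨ ℙ.+-comm (sgn (transpose {suc (suc n)} zero (suc zero) ⟨$⟩ʳ_)) (sgn δ′) ⟩
      sgn (δ ⟨$⟩ʳ_) + sgn (transpose {suc (suc n)} zero (suc zero) ⟨$⟩ʳ_) ∎))
    (sgn-transpose₀₁ {n})
    where
      open ≡-Reasoning
      -- `k` is the point that (0 i) sends to j, and it is not 0 because i ≠ j. Hence δ sends 0 to 0
      -- and then to i, and 1 to k and then to j.
      k = PC.transpose zero i j
      δ = transpose (suc zero) k ∘ₚ transpose zero i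
      δ′ = δ ⟨$⟩ʳ_
      t0i-k : PC.transpose zero i k ≡ j
      t0i-k = trans (cong (PC.transpose zero i) (transpose-comm zero i j)) (PC.transpose-inverse zero i)
      k≢0 : zero ≢ k
      k≢0 0≡k = i≢j (trans (sym (transpose-matchˡ zero i)) (trans (cong (PC.transpose zero i) 0≡k) t0i-k))
      δ0 : δ′ zero ≡ i
      δ0 = trans (cong (PC.transpose zero i) (transpose-other (suc zero) k (λ ()) k≢0)) (transpose-matchˡ zero i)
      δ1 : δ′ (suc zero) ≡ j
      δ1 = trans (cong (PC.transpose zero i) (transpose-matchˡ (suc zero) k)) t0i-k
      δ-injective : ∀ {x y} → δ′ x ≡ δ′ y → x ≡ y
      δ-injective {x} {y} = ⟨$⟩ʳ-injective δ {x} {y}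
      conj : ∀ x → PC.transpose i j (δ′ x) ≡ δ′ (PC.transpose zero (suc zero) x)
      conj zero       = trans (cong (PC.transpose i j) δ0) (trans (transpose-matchˡ i j) (sym δ1))
      conj (suc zero) = trans (cong (PC.transpose i j) δ1) (trans (transpose-matchʳ i j) (sym δ0))
      conj (suc (suc x)) = transpose-other i j
        (λ eq → Fin.0≢1+n (sym (δ-injective {suc (suc x)} {zero} (trans eq (sym δ0)))))
        (λ eq → Fin.0≢1+n (sym (Fin.suc-injective (δ-injective {suc (suc x)} {suc zero} (trans eq (sym δ1))))))

  sgn-transpose-≡ : ∀ {n} (i : Fin n) → sgn (transpose i i ⟨$⟩ʳ_) ≡ 0ℙ
  sgn-transpose-≡ {n} i = trans (sgn-cong (transpose-same i)) (sgn-id {n})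

  module _ {q m : ℕ} (κ : Fin q → Fin m) (κ-injective : ∀ {x y} → κ x ≡ κ y → x ≡ y) where

    sgn-transpose-embed : ∀ i j → sgn (transpose (κ i) (κ j) ⟨$⟩ʳ_) ≡ sgn (transpose i j ⟨$⟩ʳ_)
    sgn-transpose-embed i j with i ≟ j
    ... | yes refl = trans (sgn-transpose-≡ (κ i)) (sym (sgn-transpose-≡ i))
    ... | no i≢j   = trans (sgn-transpose-≢ (i≢j ∘ κ-injective)) (sym (sgn-transpose-≢ i≢j))

    transpose-embed : ∀ i j z → PC.transpose (κ i) (κ j) (κ z) ≡ κ (PC.transpose i j z)
    transpose-embed i j z with z ≟ i
    ... | yes refl = transpose-matchˡ (κ z) (κ j)
    ... | no z≢i with z ≟ j
    ...   | yes refl = transpose-matchʳ (κ i) (κ z)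
    ...   | no z≢j = transpose-other (κ i) (κ j) (z≢i ∘ κ-injective) (z≢j ∘ κ-injective)

    private
      -- Composing `P` with the embedded head of the list cancels that head and flips both signs
      -- alike.
      sgn-embed-eval : (xs : TranspositionList q) (P : Permutation′ m) →
        (∀ z → P ⟨$⟩ʳ κ z ≡ κ (eval xs ⟨$⟩ʳ z)) → (∀ y → (∀ z → y ≢ κ z) → P ⟨$⟩ʳ y ≡ y) →
        sgn (P ⟨$⟩ʳ_) ≡ sgn (eval xs ⟨$⟩ʳ_)
      sgn-embed-eval [] P on off = trans (sgn-cong P≗id) (trans (sgn-id {m}) (sym (sgn-id {q})))
        where
          P≗id : ∀ y → P ⟨$⟩ʳ y ≡ y
          P≗id y with any? (λ z → y ≟ κ z)
          ... | yes (z , refl) = on z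
          ... | no ∄z = off y λ z y≡κz → ∄z (z , y≡κz)
      sgn-embed-eval ((i , j) ∷ xs) P on off = ℙ.+-cancelˡ-≡ (sgn (transpose i j ⟨$⟩ʳ_)) _ _ (begin
        sgn (transpose i j ⟨$⟩ʳ_) + sgn (P ⟨$⟩ʳ_)
          ≡⟨ cong (_+ sgn (P ⟨$⟩ʳ_)) (sgn-transpose-embed i j) ⟨
        sgn (transpose (κ i) (κ j) ⟨$⟩ʳ_) + sgn (P ⟨$⟩ʳ_)
          ≡⟨ sgn-∘ (transpose (κ i) (κ j)) P ⟨
        sgn ((transpose (κ i) (κ j) ∘ₚ P) ⟨$⟩ʳ_)
          ≡⟨ sgn-embed-eval xs (transpose (κ i) (κ j) ∘ₚ P) on′ off′ ⟩
        sgn (eval xs ⟨$⟩ʳ_)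
          ≡⟨ cong (_+ sgn (eval xs ⟨$⟩ʳ_)) (ℙ.p+p≡0ℙ (sgn (transpose i j ⟨$⟩ʳ_))) ⟨
        (sgn (transpose i j ⟨$⟩ʳ_) + sgn (transpose i j ⟨$⟩ʳ_)) + sgn (eval xs ⟨$⟩ʳ_)
          ≡⟨ ℙ.+-assoc (sgn (transpose i j ⟨$⟩ʳ_)) _ _ ⟩
        sgn (transpose i j ⟨$⟩ʳ_) + (sgn (transpose i j ⟨$⟩ʳ_) + sgn (eval xs ⟨$⟩ʳ_))
          ≡⟨ cong (sgn (transpose i j ⟨$⟩ʳ_) +_) (sgn-∘ (transpose i j) (eval xs)) ⟨
        sgn (transpose i j ⟨$⟩ʳ_) + sgn (eval ((i , j) ∷ xs) ⟨$⟩ʳ_) ∎)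
        where
          open ≡-Reasoning
          on′ : ∀ z → P ⟨$⟩ʳ PC.transpose (κ i) (κ j) (κ z) ≡ κ (eval xs ⟨$⟩ʳ z)
          on′ z = trans (cong (P ⟨$⟩ʳ_) (transpose-embed i j z))
                 (trans (on (PC.transpose i j z))
                        (cong (λ y → κ (eval xs ⟨$⟩ʳ y))
                          (trans (cong (PC.transpose i j) (transpose-comm i j z)) (PC.transpose-inverse i j))))
          off′ : ∀ y → (∀ z → y ≢ κ z) → P ⟨$⟩ʳ PC.transpose (κ i) (κ j) y ≡ y
          off′ y y∉κ = trans (cong (P ⟨$⟩ʳ_) (transpose-other (κ i) (κ j) (y∉κ i) (y∉κ j))) (off y y∉κ)

    -- κ need not be monotone, so the inversions of `P` and σ do not correspond. Instead σ is
    -- written as a product of transpositions, whose signs do not depend on where they are embedded.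
    sgn-embed : (P : Permutation′ m) (σ : Permutation′ q) →
      (∀ z → P ⟨$⟩ʳ κ z ≡ κ (σ ⟨$⟩ʳ z)) → (∀ y → (∀ z → y ≢ κ z) → P ⟨$⟩ʳ y ≡ y) →
      sgn (P ⟨$⟩ʳ_) ≡ sgn (σ ⟨$⟩ʳ_)
    sgn-embed P σ on off = trans
      (sgn-embed-eval (decompose σ) P (λ z → trans (on z) (cong κ (sym (eval-decompose σ z)))) off)
      (sgn-cong (eval-decompose σ))

-- τ-parities as signs of permutations of the n² cells.

module Parities where

  open Signs
  import Algebra.Properties.CommutativeMonoid.Sum as Sum
  open import Data.Fin.Base using (Fin; combine; remQuot)
  open import Data.Fin.Permutation using (Permutation′; permutation; _⟨$⟩ʳ_; _∘ₚ_; flip; inverseʳ)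
  import Data.Fin.Properties as Fin
  open import Data.Nat.Base as ℕ using (ℕ)
  open import Data.Parity.Base using (Parity; _+_)
  import Data.Parity.Properties as ℙ
  open import Data.Product.Base using (_×_; _,_; proj₁; proj₂)
  open import Function.Base using (_∘_)
  open import Relation.Binary.PropositionalEquality
  open import Relation.Nullary using (¬_)
  open Sum ℙ.+-0-commutativeMonoid using (sum-cong-≗)

  sgn-flip : ∀ {n} (γ : Permutation′ n) → sgn (flip γ ⟨$⟩ʳ_) ≡ sgn (γ ⟨$⟩ʳ_)
  sgn-flip {n} γ = +-≡0⇒≡ (trans (sym (sgn-∘ (flip γ) γ)) (trans (sgn-cong (λ _ → inverseʳ γ)) (sgn-id {n})))

  swapₚ : ∀ n → Permutation′ (n ℕ.* n)
  swapₚ n = permutation swap swap swap-swap swap-swap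
    where
      swap : Fin (n ℕ.* n) → Fin (n ℕ.* n)
      swap z = let x , y = remQuot {n} n z in combine y x
      swap-swap : ∀ z → swap (swap z) ≡ z
      swap-swap z = trans
        (cong (λ (x , y) → combine y x) (Fin.remQuot-combine (proj₂ (remQuot {n} n z)) (proj₁ (remQuot {n} n z))))
        (Fin.combine-remQuot {n} n z)

  swapₚ-combine : ∀ {n} (x y : Fin n) → swapₚ n ⟨$⟩ʳ combine x y ≡ combine y x
  swapₚ-combine x y = cong (λ (x , y) → combine y x) (Fin.remQuot-combine x y)

  module _ {k n : ℕ} (A : OA k n) where
    open OA A

    entry-rowAtˡ : ∀ {c i} (c≢i : c ≢ i) s x → entry (rowAt A c≢i s x) c ≡ s
    entry-rowAtˡ c≢i s x = proj₁ (proj₁ (proj₂ (orthogonal c≢i s x)))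

    entry-rowAtʳ : ∀ {c i} (c≢i : c ≢ i) s x → entry (rowAt A c≢i s x) i ≡ x
    entry-rowAtʳ c≢i s x = proj₂ (proj₁ (proj₂ (orthogonal c≢i s x)))

    rowAt-entry : ∀ {c i} (c≢i : c ≢ i) r → rowAt A c≢i (entry r c) (entry r i) ≡ r
    rowAt-entry c≢i r = proj₂ (proj₂ (orthogonal c≢i _ _)) (refl , refl)

    entries : Fin k → Fin k → Fin (n ℕ.* n) → Fin (n ℕ.* n)
    entries c i r = combine (entry r c) (entry r i)

    entriesₚ : ∀ {c i} → c ≢ i → Permutation′ (n ℕ.* n)
    entriesₚ {c} {i} c≢i = permutation (entries c i) row entries-row row-entries
      where
        row : Fin (n ℕ.* n) → Fin (n ℕ.* n)
        row z = let s , x = remQuot {n} n z in rowAt A c≢i s x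
        entries-row : ∀ z → entries c i (row z) ≡ z
        entries-row z = trans (cong₂ combine (entry-rowAtˡ c≢i _ _) (entry-rowAtʳ c≢i _ _)) (Fin.combine-remQuot {n} n z)
        row-entries : ∀ r → row (entries c i r) ≡ r
        row-entries r = trans (cong (λ (s , x) → rowAt A c≢i s x) (Fin.remQuot-combine (entry r c) (entry r i)))
                              (rowAt-entry c≢i r)

    -- This depends on the numbering of the rows, but renumbering adds one common sign to all φ c i
    -- with c ≠ i, which cancels in τ.
    φ : Fin k → Fin k → Parity
    φ c i = sgn (entries c i)

    φ-swap : ∀ {c i} → c ≢ i → φ i c ≡ φ c i + sgn (swapₚ n ⟨$⟩ʳ_)
    φ-swap {c} {i} c≢i = trans
      (sgn-cong λ r → sym (swapₚ-combine (entry r c) (entry r i)))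
      (sgn-∘ (entriesₚ c≢i) (swapₚ n))

    -- From a cell of columns c, i to its row and on to the cell of columns c, j: a block map whose
    -- block at s is ρ_s(c,i,j).
    columnMap : (t : Triple k) → Permutation′ (n ℕ.* n)
    columnMap t = flip (entriesₚ (Triple.c≢i t)) ∘ₚ entriesₚ (Triple.c≢j t)

    module _ (t : Triple k) where
      open Triple t

      columnMap-combine : ∀ s x → columnMap t ⟨$⟩ʳ combine s x ≡ combine s (ρ-to A c≢i j s x)
      columnMap-combine s x = trans
        (cong (λ (s , x) → entries c j (rowAt A c≢i s x)) (Fin.remQuot-combine s x))
        (cong (λ u → combine u (ρ-to A c≢i j s x)) (entry-rowAtˡ c≢i s x))

      flip-columnMap-combine : ∀ s y → flip (columnMap t) ⟨$⟩ʳ combine s y ≡ combine s (ρ-to A c≢j i s y)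
      flip-columnMap-combine s y = trans
        (cong (λ (s , x) → entries c i (rowAt A c≢j s x)) (Fin.remQuot-combine s y))
        (cong (λ u → combine u (ρ-to A c≢j i s y)) (entry-rowAtˡ c≢j s y))

      τ≡sgn : τ A t ≡ sgn (columnMap t ⟨$⟩ʳ_)
      τ≡sgn = sym (trans
        (sgn-blocks (columnMap t ⟨$⟩ʳ_) (ρ-to A c≢i j) columnMap-combine)
        (sum-cong-≗ {n} λ s → sym (π≡sgn (ρ A c≢i c≢j s))))

      τ≡φ+φ : τ A t ≡ φ c i + φ c j
      τ≡φ+φ = trans τ≡sgn (trans (sgn-∘ (flip (entriesₚ c≢i)) (entriesₚ c≢j))
        (cong (_+ φ c j) (sgn-flip (entriesₚ c≢i))))

  -- Outside the subarray the two arrays agree, so columnMap A′ ∘ (columnMap A)⁻¹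
  -- is the image of columnMap B′ ∘ (columnMap B)⁻¹ under ι c × ι j.
  module _ {k n q : ℕ} (A A′ : OA k n) (B B′ : OA k q)
    (ι : Fin k → Fin q → Fin n) (ι-injective : ∀ c {x y} → ι c x ≡ ι c y → x ≡ y)
    (on  : ∀ {c i} (c≢i : c ≢ i) j x y → ρ-to A  c≢i j (ι c x) (ι i y) ≡ ι j (ρ-to B  c≢i j x y))
    (on′ : ∀ {c i} (c≢i : c ≢ i) j x y → ρ-to A′ c≢i j (ι c x) (ι i y) ≡ ι j (ρ-to B′ c≢i j x y))
    (off : ∀ {c i} (c≢i : c ≢ i) j s x → ¬ (∃[ s₀ ] ∃[ x₀ ] (s ≡ ι c s₀ × x ≡ ι i x₀)) →
           ρ-to A c≢i j s x ≡ ρ-to A′ c≢i j s x)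
    where

    τ-trade : ∀ t → τ A t + τ A′ t ≡ τ B t + τ B′ t
    τ-trade t = begin
      τ A t + τ A′ t                        ≡⟨ difference A A′ ⟩
      sgn (Q ⟨$⟩ʳ_)                         ≡⟨ sgn-embed κ κ-injective Q QB Q-on Q-off ⟩
      sgn (QB ⟨$⟩ʳ_)                        ≡⟨ difference B B′ ⟨
      τ B t + τ B′ t                        ∎
      where
        open ≡-Reasoning
        open Triple t
        difference : ∀ {m} (X Y : OA k m) → τ X t + τ Y t ≡ sgn ((flip (columnMap X t) ∘ₚ columnMap Y t) ⟨$⟩ʳ_)
        difference X Y = sym (trans (sgn-∘ (flip (columnMap X t)) (columnMap Y t))
          (cong₂ _+_ (trans (sgn-flip (columnMap X t)) (sym (τ≡sgn X t))) (sym (τ≡sgn Y t))))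
        -- `Q` acts on cells of columns c, j: back along the first array, forth along the second.
        -- Inversion keeps the sign, so sgn Q is the sum of the two τ.
        Q  = flip (columnMap A t) ∘ₚ columnMap A′ t
        QB = flip (columnMap B t) ∘ₚ columnMap B′ t
        Q-combine : ∀ {m} (X Y : OA k m) s y → (flip (columnMap X t) ∘ₚ columnMap Y t) ⟨$⟩ʳ combine s y
                    ≡ combine s (ρ-to Y c≢i j s (ρ-to X c≢j i s y))
        Q-combine X Y s y = trans (cong (columnMap Y t ⟨$⟩ʳ_) (flip-columnMap-combine X t s y))
                                  (columnMap-combine Y t s _)
        κ : Fin (q ℕ.* q) → Fin (n ℕ.* n)
        κ z = let a , b = remQuot {q} q z in combine (ι c a) (ι j b)
        κ-combine : ∀ a b → κ (combine a b) ≡ combine (ι c a) (ι j b)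
        κ-combine a b = cong (λ (a , b) → combine (ι c a) (ι j b)) (Fin.remQuot-combine a b)
        κ-injective : ∀ {y z} → κ y ≡ κ z → y ≡ z
        κ-injective {y} {z} eq =
          let a≡ , b≡ = Fin.combine-injective _ _ _ _ eq in
          trans (sym (Fin.combine-remQuot {q} q y))
         (trans (cong₂ combine (ι-injective c a≡) (ι-injective j b≡)) (Fin.combine-remQuot {q} q z))
        Q-on′ : ∀ a b → Q ⟨$⟩ʳ κ (combine a b) ≡ κ (QB ⟨$⟩ʳ combine a b)
        Q-on′ a b = begin
          Q ⟨$⟩ʳ κ (combine a b)
            ≡⟨ cong (Q ⟨$⟩ʳ_) (κ-combine a b) ⟩
          Q ⟨$⟩ʳ combine (ι c a) (ι j b)
            ≡⟨ Q-combine A A′ _ _ ⟩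
          combine (ι c a) (ρ-to A′ c≢i j (ι c a) (ρ-to A c≢j i (ι c a) (ι j b)))
            ≡⟨ cong (λ x → combine (ι c a) (ρ-to A′ c≢i j (ι c a) x)) (on c≢j i a b) ⟩
          combine (ι c a) (ρ-to A′ c≢i j (ι c a) (ι i (ρ-to B c≢j i a b)))
            ≡⟨ cong (combine (ι c a)) (on′ c≢i j a _) ⟩
          combine (ι c a) (ι j (ρ-to B′ c≢i j a (ρ-to B c≢j i a b)))
            ≡⟨ κ-combine a _ ⟨
          κ (combine a (ρ-to B′ c≢i j a (ρ-to B c≢j i a b)))
            ≡⟨ cong κ (Q-combine B B′ a b) ⟨
          κ (QB ⟨$⟩ʳ combine a b) ∎
        Q-on : ∀ z → Q ⟨$⟩ʳ κ z ≡ κ (QB ⟨$⟩ʳ z)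
        Q-on z = subst (λ z → Q ⟨$⟩ʳ κ z ≡ κ (QB ⟨$⟩ʳ z)) (Fin.combine-remQuot {q} q z) (Q-on′ _ _)
        Q-off′ : ∀ s y → (∀ z → combine s y ≢ κ z) → Q ⟨$⟩ʳ combine s y ≡ combine s y
        Q-off′ s y ∉κ = trans (Q-combine A A′ s y) (cong (combine s)
          (trans (sym (off c≢i j s x ∉B)) (ρ-to-inverse A c≢j c≢i s y)))
          where
            x = ρ-to A c≢j i s y
            ∉B : ¬ (∃[ s₀ ] ∃[ x₀ ] (s ≡ ι c s₀ × x ≡ ι i x₀))
            -- A pair inside the subarray in columns c, i would, by `on`, stay inside it in column
            -- j, making (s, y) a value of κ.
            ∉B (s₀ , x₀ , s≡ , x≡) = ∉κ (combine s₀ (ρ-to B c≢i j s₀ x₀)) (begin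
              combine s y                                        ≡⟨ cong (combine s) (ρ-to-inverse A c≢j c≢i s y) ⟨
              combine s (ρ-to A c≢i j s x)                       ≡⟨ cong₂ (λ s x → combine s (ρ-to A c≢i j s x)) s≡ x≡ ⟩
              combine (ι c s₀) (ρ-to A c≢i j (ι c s₀) (ι i x₀))  ≡⟨ cong (combine (ι c s₀)) (on c≢i j s₀ x₀) ⟩
              combine (ι c s₀) (ι j (ρ-to B c≢i j s₀ x₀))        ≡⟨ κ-combine _ _ ⟨
              κ (combine s₀ (ρ-to B c≢i j s₀ x₀))                ∎)
        Q-off : ∀ y → (∀ z → y ≢ κ z) → Q ⟨$⟩ʳ y ≡ y
        Q-off y = subst (λ y → (∀ z → y ≢ κ z) → Q ⟨$⟩ʳ y ≡ y) (Fin.combine-remQuot {n} n y) (Q-off′ _ _)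

-- Arrays over arbitrary alphabets, products and Wilson's construction.

module Arrays where

  open Signs
  open Parities
  open import Data.Empty using (⊥-elim)
  open import Data.Fin.Base using (Fin; zero; suc; combine; remQuot)
  import Data.Fin.Properties as Fin
  open import Data.Maybe.Base using (Maybe; just; nothing)
  open import Data.Nat.Base as ℕ using (ℕ; zero; suc)
  open import Data.Product.Base using (Σ; _×_; _,_)
  open import Data.Sum.Base using (_⊎_; inj₁; inj₂)
  open import Function.Base using (_∘_; case_of_)
  open import Function.Bundles using (_↔_; Inverse)
  open import Relation.Binary.PropositionalEquality
  open import Relation.Nullary using (¬_)

  -- Rows form any type, and `at-all` fixes a row only up to its entries, so one row may have many
  -- representatives, such as integer pairs modulo n.
  record Array (k : ℕ) (Λ : Set) : Set₁ where
    field
      Row    : Set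
      entry  : Row → Fin k → Λ
      at     : ∀ {c i} → c ≢ i → Λ → Λ → Row
      at-fst : ∀ {c i} (c≢i : c ≢ i) s x → entry (at c≢i s x) c ≡ s
      at-snd : ∀ {c i} (c≢i : c ≢ i) s x → entry (at c≢i s x) i ≡ x
      at-all : ∀ {c i} (c≢i : c ≢ i) r j → entry (at c≢i (entry r c) (entry r i)) j ≡ entry r j

    line : ∀ {c i} → c ≢ i → Λ → Λ → Fin k → Λ
    line c≢i s x = entry (at c≢i s x)

    at-row : ∀ {c i} (c≢i : c ≢ i) r j {s x} → entry r c ≡ s → entry r i ≡ x → line c≢i s x j ≡ entry r j
    at-row c≢i r j refl refl = at-all c≢i r j

    -- Expresses through lines that the constant row z belongs to the array.
    Idempotent : Λ → Set
    Idempotent z = ∀ {c i} (c≢i : c ≢ i) j → line c≢i z z j ≡ z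

    constant-row : ∀ {z} r → (∀ j → entry r j ≡ z) → Idempotent z
    constant-row r r≡z c≢i j = trans (at-row c≢i r j (r≡z _) (r≡z _)) (r≡z j)

  open Array

  relabel : ∀ {k Λ Λ′} → Λ ↔ Λ′ → Array k Λ → Array k Λ′
  relabel iso A = record
    { Row    = Row A
    ; entry  = λ r j → to (entry A r j)
    ; at     = λ c≢i s x → at A c≢i (from s) (from x)
    ; at-fst = λ c≢i s x → trans (cong to (at-fst A c≢i _ _)) (strictlyInverseˡ s)
    ; at-snd = λ c≢i s x → trans (cong to (at-snd A c≢i _ _)) (strictlyInverseˡ x)
    ; at-all = λ c≢i r j → cong to (at-row A c≢i r j (sym (strictlyInverseʳ _)) (sym (strictlyInverseʳ _)))
    }
    where open Inverse iso

  dropColumn : ∀ {k Λ} → Array (suc k) Λ → Array k Λ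
  dropColumn A = record
    { Row    = Row A
    ; entry  = λ r j → entry A r (suc j)
    ; at     = λ c≢i → at A (c≢i ∘ Fin.suc-injective)
    ; at-fst = λ c≢i → at-fst A (c≢i ∘ Fin.suc-injective)
    ; at-snd = λ c≢i → at-snd A (c≢i ∘ Fin.suc-injective)
    ; at-all = λ c≢i r j → at-all A (c≢i ∘ Fin.suc-injective) r (suc j)
    }

  module _ {k n : ℕ} {Λ : Set} (iso : Λ ↔ Fin n) (A : Array (suc (suc k)) Λ) where
    open Inverse iso

    private
      0≢1 : _≢_ {A = Fin (suc (suc k))} zero (suc zero)
      0≢1 ()

      index : Row A → Fin (n ℕ.* n)
      index r = combine (to (entry A r zero)) (to (entry A r (suc zero)))

      row : Fin (n ℕ.* n) → Row A
      row z = let a , b = remQuot {n} n z in at A 0≢1 (from a) (from b)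

      row-index : ∀ r j → entry A (row (index r)) j ≡ entry A r j
      row-index r j = trans
        (cong (λ (a , b) → line A 0≢1 (from a) (from b) j) (Fin.remQuot-combine _ _))
        (at-row A 0≢1 r j (sym (strictlyInverseʳ _)) (sym (strictlyInverseʳ _)))

      index-row : ∀ z → index (row z) ≡ z
      index-row z = trans
        (cong₂ combine (trans (cong to (at-fst A 0≢1 _ _)) (strictlyInverseˡ _))
                       (trans (cong to (at-snd A 0≢1 _ _)) (strictlyInverseˡ _)))
        (Fin.combine-remQuot {n} n z)

    -- Rows are numbered by their entries in the first two columns, which also selects one
    -- representative of each row.
    toOA : OA (suc (suc k)) n
    toOA = record
      { entry      = λ z j → to (entry A (row z) j)
      ; orthogonal = λ {i} {j} i≢j x y →
          let r = at A i≢j (from x) (from y) in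
          index r ,
          ( trans (cong to (trans (row-index r i) (at-fst A i≢j _ _))) (strictlyInverseˡ x)
          , trans (cong to (trans (row-index r j) (at-snd A i≢j _ _))) (strictlyInverseˡ y)) ,
          λ { {z} (refl , refl) →
            trans (cong₂ combine
                    (cong to (at-row A i≢j (row z) zero (sym (strictlyInverseʳ _)) (sym (strictlyInverseʳ _))))
                    (cong to (at-row A i≢j (row z) (suc zero) (sym (strictlyInverseʳ _)) (sym (strictlyInverseʳ _)))))
                  (index-row z) }
      }

    ρ-to-toOA : ∀ {c i} (c≢i : c ≢ i) j s x → ρ-to toOA c≢i j s x ≡ to (line A c≢i (from s) (from x) j)
    ρ-to-toOA c≢i j s x = cong to (row-index _ j)

  module _ {k : ℕ} {Γ Μ : Set} (W : Array (suc (suc k)) Γ) (fill : Γ → Γ → Array (suc (suc k)) Μ) where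

    private
      fillAt : Row W → Array (suc (suc k)) Μ
      fillAt b = fill (entry W b zero) (entry W b (suc zero))

    -- `fill` sees only the first two entries, so representatives of the same row of `W` get the
    -- same filling. Filling each row on its own is what allows local replacement later.
    product : Array (suc (suc k)) (Γ × Μ)
    product = record
      { Row    = Σ (Row W) (Row ∘ fillAt)
      ; entry  = λ (b , r) j → entry W b j , entry (fillAt b) r j
      ; at     = λ c≢i (g , a) (h , b) → at W c≢i g h , at (fillAt (at W c≢i g h)) c≢i a b
      ; at-fst = λ c≢i (g , a) (h , b) → cong₂ _,_ (at-fst W c≢i g h) (at-fst (fillAt (at W c≢i g h)) c≢i a b)
      ; at-snd = λ c≢i (g , a) (h , b) → cong₂ _,_ (at-snd W c≢i g h) (at-snd (fillAt (at W c≢i g h)) c≢i a b)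
      ; at-all = λ c≢i (b , r) j → cong₂ _,_ (at-all W c≢i b j) (trans
          (cong₂ (λ x y → line (fill x y) c≢i (entry (fillAt b) r _) (entry (fillAt b) r _) j)
             (at-all W c≢i b zero) (at-all W c≢i b (suc zero)))
          (at-all (fillAt b) c≢i r j))
      }

    product-idempotent : ∀ {g a} → Idempotent W g → Idempotent (fill g g) a → Idempotent product (g , a)
    product-idempotent {g} {a} idemW idemF c≢i j = cong₂ _,_ (idemW c≢i j) (trans
      (cong₂ (λ x y → line (fill x y) c≢i a a j) (idemW c≢i zero) (idemW c≢i (suc zero)))
      (idemF c≢i j))

  -- Wilson's construction: column zero of T is truncated to U. A block of T is blown
  -- up by M if it misses U, and by M⁺ (order one more, extra symbol nothing) without
  -- its constant row if it meets U; D fills the hole U.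
  module Wilson {k : ℕ} {U V Μ : Set} (T : Array (suc k) (U ⊎ V)) (M : Array k Μ)
    (M⁺ : Array k (Maybe Μ)) (M⁺-idem : Idempotent M⁺ nothing) where

    Symbol : Set
    Symbol = ((U ⊎ V) × Μ) ⊎ U

    blow : U → U ⊎ V → Maybe Μ → Symbol
    blow u g nothing  = inj₂ u
    blow u g (just a) = inj₁ (g , a)

    module _ (D : Array k U) where

      data WRow : Set where
        outside : (b : Row T) (v : V) → entry T b zero ≡ inj₂ v → Row M → WRow
        through : (b : Row T) (u : U) → entry T b zero ≡ inj₁ u → (r : Row M⁺) →
                  (∀ {c i} → c ≢ i → entry M⁺ r c ≡ nothing → ¬ (entry M⁺ r i ≡ nothing)) → WRow
        hole    : Row D → WRow

      wEntry : WRow → Fin k → Symbol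
      wEntry (outside b v _ r)   j = inj₁ (entry T b (suc j) , entry M r j)
      wEntry (through b u _ r _) j = blow u (entry T b (suc j)) (entry M⁺ r j)
      wEntry (hole r)            j = inj₂ (entry D r j)

      lift≢ : ∀ {c i : Fin k} → c ≢ i → suc c ≢ suc i
      lift≢ c≢i = c≢i ∘ Fin.suc-injective

      0≢suc : ∀ {i : Fin k} → zero ≢ suc i
      0≢suc ()

      suc≢0 : ∀ {i : Fin k} → suc i ≢ zero
      suc≢0 ()

      -- A row with `nothing` in two columns is the constant row, by idempotence, and so has no
      -- entry `just a`.
      proper : ∀ (r : Row M⁺) {c a} → entry M⁺ r c ≡ just a →
               ∀ {c′ i′} → c′ ≢ i′ → entry M⁺ r c′ ≡ nothing → ¬ (entry M⁺ r i′ ≡ nothing)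
      proper r {c} rc c′≢i′ rc′ ri′ =
        case trans (sym rc) (trans (sym (at-row M⁺ c′≢i′ r c rc′ ri′)) (M⁺-idem c′≢i′ c)) of λ ()

      -- The truncated entry `d` comes with its equation as an argument, so that proofs can split on
      -- `d` by an auxiliary `go _ refl`.
      block : ∀ {c i : Fin k} → c ≢ i → (b : Row T) (d : U ⊎ V) → entry T b zero ≡ d → Μ → Μ → WRow
      block c≢i b (inj₂ v) eq x y = outside b v eq (at M c≢i x y)
      block c≢i b (inj₁ u) eq x y = through b u eq (at M⁺ c≢i (just x) (just y))
        (proper _ (at-fst M⁺ c≢i (just x) (just y)))

      wAt : ∀ {c i : Fin k} → c ≢ i → Symbol → Symbol → WRow
      wAt c≢i (inj₁ (g , x)) (inj₁ (h , y)) =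
        block c≢i (at T (lift≢ c≢i) g h) _ refl x y
      -- A hole symbol `u` selects the block by its truncated column and stands in the place of
      -- `nothing`.
      wAt {c} {i} c≢i (inj₁ (g , x)) (inj₂ u) = let b = at T (suc≢0 {c}) g (inj₁ u) in
        through b u (at-snd T suc≢0 g (inj₁ u)) (at M⁺ c≢i (just x) nothing)
          (proper _ (at-fst M⁺ c≢i (just x) nothing))
      wAt {c} {i} c≢i (inj₂ u) (inj₁ (h , y)) = let b = at T (0≢suc {i}) (inj₁ u) h in
        through b u (at-fst T 0≢suc (inj₁ u) h) (at M⁺ c≢i nothing (just y))
          (proper _ (at-snd M⁺ c≢i nothing (just y)))
      wAt c≢i (inj₂ u) (inj₂ u′) = hole (at D c≢i u u′)

      blow-just : ∀ {u g h m a} → g ≡ h → m ≡ just a → blow u g m ≡ inj₁ (h , a)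
      blow-just refl refl = refl

      blow-nothing : ∀ {u g m} → m ≡ nothing → blow u g m ≡ inj₂ u
      blow-nothing refl = refl

      wAt-fst : ∀ {c i} (c≢i : c ≢ i) s x → wEntry (wAt c≢i s x) c ≡ s
      wAt-fst {c} {i} c≢i (inj₁ (g , x)) (inj₁ (h , y)) = go _ refl
        where
          b = at T (lift≢ c≢i) g h
          go : ∀ d (eq : entry T b zero ≡ d) → wEntry (block c≢i b d eq x y) c ≡ inj₁ (g , x)
          go (inj₂ v) eq = cong inj₁ (cong₂ _,_ (at-fst T (lift≢ c≢i) g h) (at-fst M c≢i x y))
          go (inj₁ u) eq = blow-just (at-fst T (lift≢ c≢i) g h) (at-fst M⁺ c≢i _ _)
      wAt-fst c≢i (inj₁ (g , x)) (inj₂ u) = blow-just (at-fst T suc≢0 _ _) (at-fst M⁺ c≢i _ _)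
      wAt-fst c≢i (inj₂ u) (inj₁ (h , y)) = blow-nothing (at-fst M⁺ c≢i _ _)
      wAt-fst c≢i (inj₂ u) (inj₂ u′) = cong inj₂ (at-fst D c≢i u u′)

      wAt-snd : ∀ {c i} (c≢i : c ≢ i) s x → wEntry (wAt c≢i s x) i ≡ x
      wAt-snd {c} {i} c≢i (inj₁ (g , x)) (inj₁ (h , y)) = go _ refl
        where
          b = at T (lift≢ c≢i) g h
          go : ∀ d (eq : entry T b zero ≡ d) → wEntry (block c≢i b d eq x y) i ≡ inj₁ (h , y)
          go (inj₂ v) eq = cong inj₁ (cong₂ _,_ (at-snd T (lift≢ c≢i) g h) (at-snd M c≢i x y))
          go (inj₁ u) eq = blow-just (at-snd T (lift≢ c≢i) g h) (at-snd M⁺ c≢i _ _)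
      wAt-snd c≢i (inj₁ (g , x)) (inj₂ u) = blow-nothing (at-snd M⁺ c≢i _ _)
      wAt-snd c≢i (inj₂ u) (inj₁ (h , y)) = blow-just (at-snd T 0≢suc _ _) (at-snd M⁺ c≢i _ _)
      wAt-snd c≢i (inj₂ u) (inj₂ u′) = cong inj₂ (at-snd D c≢i u u′)

      wAt-all : ∀ {c i} (c≢i : c ≢ i) r j → wEntry (wAt c≢i (wEntry r c) (wEntry r i)) j ≡ wEntry r j
      wAt-all {c} {i} c≢i (outside b v eq r) j = go _ refl
        where
          b′ = at T (lift≢ c≢i) (entry T b (suc c)) (entry T b (suc i))
          go : ∀ d (eq′ : entry T b′ zero ≡ d) →
               wEntry (block c≢i b′ d eq′ (entry M r c) (entry M r i)) j ≡ inj₁ (entry T b (suc j) , entry M r j)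
          go (inj₂ v′) eq′ = cong inj₁ (cong₂ _,_ (at-all T (lift≢ c≢i) b (suc j)) (at-all M c≢i r j))
          go (inj₁ u) eq′ = case trans (sym eq) (trans (sym (at-all T (lift≢ c≢i) b zero)) eq′) of λ ()
      wAt-all {c} {i} c≢i (through b u eq r r-proper) j
        with entry M⁺ r c in rc | entry M⁺ r i in ri
      ... | just x | just y = go _ refl
        where
          b′ = at T (lift≢ c≢i) (entry T b (suc c)) (entry T b (suc i))
          go : ∀ d (eq′ : entry T b′ zero ≡ d) →
               wEntry (block c≢i b′ d eq′ x y) j ≡ blow u (entry T b (suc j)) (entry M⁺ r j)
          go (inj₁ u′) eq′ with refl ← trans (sym eq′) (trans (at-all T (lift≢ c≢i) b zero) eq) =
            cong₂ (blow u) (at-all T (lift≢ c≢i) b (suc j)) (at-row M⁺ c≢i r j rc ri)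
          go (inj₂ v) eq′ = case trans (sym eq) (trans (sym (at-all T (lift≢ c≢i) b zero)) eq′) of λ ()
      ... | just x  | nothing = cong₂ (blow u) (at-row T suc≢0 b (suc j) refl eq) (at-row M⁺ c≢i r j rc ri)
      ... | nothing | just y  = cong₂ (blow u) (at-row T 0≢suc b (suc j) eq refl) (at-row M⁺ c≢i r j rc ri)
      ... | nothing | nothing = ⊥-elim (r-proper c≢i rc ri)
      wAt-all c≢i (hole r) j = cong inj₂ (at-all D c≢i r j)

      wilson : Array k Symbol
      wilson = record
        { Row = WRow ; entry = wEntry ; at = wAt ; at-fst = wAt-fst ; at-snd = wAt-snd ; at-all = wAt-all }

    -- Only a pair of two hole symbols consults the array in the hole.
    line-outside : ∀ D D′ {c i} (c≢i : c ≢ i) j s x → ¬ (∃[ u ] ∃[ u′ ] (s ≡ inj₂ u × x ≡ inj₂ u′)) →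
                   line (wilson D) c≢i s x j ≡ line (wilson D′) c≢i s x j
    line-outside D D′ c≢i j (inj₁ (g , a)) (inj₁ (h , b)) _ = go _ refl
      where
        go : ∀ d (eq : entry T (at T (c≢i ∘ Fin.suc-injective) g h) zero ≡ d) →
             wEntry D (block D c≢i _ d eq a b) j ≡ wEntry D′ (block D′ c≢i _ d eq a b) j
        go (inj₁ u) eq = refl
        go (inj₂ v) eq = refl
    line-outside D D′ c≢i j (inj₁ (g , a)) (inj₂ u) _ = refl
    line-outside D D′ c≢i j (inj₂ u) (inj₁ (h , b)) _ = refl
    line-outside D D′ c≢i j (inj₂ u) (inj₂ u′) ∉U = ⊥-elim (∉U (u , u′ , refl , refl))

-- Linear arrays modulo n.

module LinearArrays where

  open Signs
  open Parities
  open Arrays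
  open import Data.Empty using (⊥-elim)
  open import Data.Fin.Base using (Fin; zero; suc; toℕ; fromℕ<)
  import Data.Fin.Properties as Fin
  open import Data.Fin.Properties using (_≟_; all?)
  open import Data.Integer.Base as ℤ using (ℤ; +_; -[1+_]; -_; _+_; _*_; ∣_∣)
  open import Data.Integer.DivMod using (_%ℕ_; _/ℕ_; n%ℕd<d; a≡a%ℕn+[a/ℕn]*n)
  import Data.Integer.Properties as ℤ
  open import Data.Integer.Tactic.RingSolver using (solve-∀)
  open import Data.Nat.Base as ℕ using (ℕ; zero; suc; NonZero)
  import Data.Nat.Properties as ℕ
  open import Data.Product.Base using (_×_; _,_; proj₁; proj₂)
  open import Data.Sum.Base using (_⊎_; inj₁; inj₂)
  open import Function.Base using (_∘_)
  open import Relation.Binary.PropositionalEquality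
  open import Relation.Nullary.Decidable using (_⊎-dec_; from-yes)

  open Array

  module _ (n : ℕ) .{{_ : NonZero n}} where

    infix 4 _≈_
    -- With the quotient as data, each closure property is a polynomial identity for the ring
    -- solver.
    record _≈_ (a b : ℤ) : Set where
      constructor by
      field
        quotient : ℤ
        equation : a ≡ b + quotient * + n

    ≈-reflexive : ∀ {a b} → a ≡ b → a ≈ b
    ≈-reflexive {a} refl = by (+ 0) (sym (ℤ.+-identityʳ a))

    ≈-sym : ∀ {a b} → a ≈ b → b ≈ a
    ≈-sym {a} {b} (by q refl) = by (- q) (lemma b q (+ n))
      where
        lemma : ∀ b q n → b ≡ (b + q * n) + - q * n
        lemma = solve-∀

    ≈-trans : ∀ {a b c} → a ≈ b → b ≈ c → a ≈ c
    ≈-trans {c = c} (by q refl) (by r refl) = by (r + q) (lemma c r q (+ n))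
      where
        lemma : ∀ c r q n → (c + r * n) + q * n ≡ c + (r + q) * n
        lemma = solve-∀

    ≈-+ : ∀ {a b c d} → a ≈ b → c ≈ d → a + c ≈ b + d
    ≈-+ {b = b} {d = d} (by q refl) (by r refl) = by (q + r) (lemma b d q r (+ n))
      where
        lemma : ∀ b d q r n → (b + q * n) + (d + r * n) ≡ (b + d) + (q + r) * n
        lemma = solve-∀

    ≈-* : ∀ {a b c d} → a ≈ b → c ≈ d → a * c ≈ b * d
    ≈-* {b = b} {d = d} (by q refl) (by r refl) = by (q * d + b * r + q * r * + n) (lemma b d q r (+ n))
      where
        lemma : ∀ b d q r n → (b + q * n) * (d + r * n) ≡ b * d + (q * d + b * r + q * r * n) * n
        lemma = solve-∀

    ≈-*ˡ : ∀ c {a b} → a ≈ b → c * a ≈ c * b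
    ≈-*ˡ c {a} {b} = ≈-* {c} {c} {a} {b} (≈-reflexive refl)

    -- |q| n = |u - v| < n forces q = 0.
    residue-unique : ∀ {u v} → u ℕ.< n → v ℕ.< n → + u ≈ + v → u ≡ v
    residue-unique {u} {v} u<n v<n (by q eq) = ℤ.+-injective (trans eq (trans (cong (λ q → + v + q * + n) q≡0) (ℤ.+-identityʳ (+ v))))
      where
        open ≡-Reasoning
        cancel : ∀ v x → x ≡ (v + x) + - v
        cancel = solve-∀
        size : ∣ q ∣ ℕ.* n ≡ ∣ + u + - + v ∣
        size = begin
          ∣ q ∣ ℕ.* n                 ≡⟨ ℤ.abs-* q (+ n) ⟨
          ∣ q * + n ∣                 ≡⟨ cong ∣_∣ (cancel (+ v) (q * + n)) ⟩
          ∣ + v + q * + n + - + v ∣   ≡⟨ cong (λ z → ∣ z + - + v ∣) eq ⟨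
          ∣ + u + - + v ∣             ∎
        small : ∣ + u + - + v ∣ ℕ.< n
        small = ℕ.≤-<-trans (ℕ.≤-reflexive (cong ∣_∣ (ℤ.m-n≡m⊖n u v)))
               (ℕ.≤-<-trans (ℤ.∣m⊝n∣≤m⊔n u v) (ℕ.⊔-lub u<n v<n))
        q≡0 : q ≡ + 0
        q≡0 = ℤ.∣i∣≡0⇒i≡0 (ℕ.n<1⇒n≡0 (ℕ.*-cancelʳ-< n ∣ q ∣ 1
          (subst₂ ℕ._<_ (sym size) (sym (ℕ.*-identityˡ n)) small)))

    red : ℤ → Fin n
    red a = fromℕ< (n%ℕd<d a n)

    rep : Fin n → ℤ
    rep x = + toℕ x

    private
      ≈-% : ∀ a → a ≈ + (a %ℕ n)
      ≈-% a = by (a /ℕ n) (a≡a%ℕn+[a/ℕn]*n a n)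

    rep-red : ∀ a → rep (red a) ≈ a
    rep-red a = ≈-trans (≈-reflexive (cong +_ (Fin.toℕ-fromℕ< (n%ℕd<d a n)))) (≈-sym (≈-% a))

    red-cong : ∀ {a b} → a ≈ b → red a ≡ red b
    red-cong {a} {b} a≈b = Fin.toℕ-injective (residue-unique (Fin.toℕ<n (red a)) (Fin.toℕ<n (red b))
      (≈-trans (rep-red a) (≈-trans a≈b (≈-sym (rep-red b)))))

    red-rep : ∀ x → red (rep x) ≡ x
    red-rep x = Fin.toℕ-injective (residue-unique (Fin.toℕ<n (red (rep x))) (Fin.toℕ<n x) (rep-red (rep x)))

    module Linear {k : ℕ} (α β : Fin k → ℤ) (e : Fin k → Fin k → ℤ) where

      det : Fin k → Fin k → ℤ
      det c i = α c * β i + - (α i * β c)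

      -- Cramer's rule, with `e c i` in the role of 1 / det c i: the entry in column j of the row
      -- with s in column c and x in column i.
      value : Fin k → Fin k → Fin k → ℤ → ℤ → ℤ
      value c i j s x = (e c i * det c j) * x + (e c i * det j i) * s

      value-cong : ∀ c i j {s s′ x x′} → s ≈ s′ → x ≈ x′ → value c i j s x ≈ value c i j s′ x′
      value-cong c i j s≈s′ x≈x′ = ≈-+ (≈-*ˡ (e c i * det c j) x≈x′) (≈-*ˡ (e c i * det j i) s≈s′)

      module _ (unit : ∀ {c i} → c ≢ i → e c i * det c i ≈ + 1) where

        private
          lEntry : ℤ × ℤ → Fin k → Fin n
          lEntry (x , y) j = red (α j * x + β j * y)

          lAt : ∀ {c i : Fin k} → c ≢ i → Fin n → Fin n → ℤ × ℤ
          lAt {c} {i} c≢i s x =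
            e c i * (β i * rep s + - (β c * rep x)) , e c i * (α c * rep x + - (α i * rep s))

          lEntry-at : ∀ {c i} (c≢i : c ≢ i) j s x → lEntry (lAt c≢i s x) j ≡ red (value c i j (rep s) (rep x))
          lEntry-at {c} {i} c≢i j s x = cong red (lemma (e c i) (α c) (β c) (α i) (β i) (α j) (β j) (rep s) (rep x))
            where
              lemma : ∀ e αc βc αi βi αj βj s x →
                αj * (e * (βi * s + - (βc * x))) + βj * (e * (αc * x + - (αi * s)))
                ≡ (e * (αc * βj + - (αj * βc))) * x + (e * (αj * βi + - (αi * βj))) * s
              lemma = solve-∀

          unit-cancel : ∀ {c i} → c ≢ i → ∀ s → (e c i * det c i) * s ≈ s
          unit-cancel c≢i s = ≈-trans (≈-* (unit c≢i) (≈-reflexive refl)) (≈-reflexive (ℤ.*-identityˡ s))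

          lAt-fst : ∀ {c i} (c≢i : c ≢ i) s x → lEntry (lAt c≢i s x) c ≡ s
          lAt-fst {c} {i} c≢i s x = trans (lEntry-at c≢i c s x) (trans
            (red-cong (≈-trans (≈-reflexive (lemma (e c i) (α c) (β c) (det c i) (rep s) (rep x)))
                               (unit-cancel c≢i (rep s))))
            (red-rep s))
            where
              lemma : ∀ e αc βc d s x → (e * (αc * βc + - (αc * βc))) * x + (e * d) * s ≡ (e * d) * s
              lemma = solve-∀

          lAt-snd : ∀ {c i} (c≢i : c ≢ i) s x → lEntry (lAt c≢i s x) i ≡ x
          lAt-snd {c} {i} c≢i s x = trans (lEntry-at c≢i i s x) (trans
            (red-cong (≈-trans (≈-reflexive (lemma (e c i) (α i) (β i) (det c i) (rep s) (rep x)))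
                               (unit-cancel c≢i (rep x))))
            (red-rep x))
            where
              lemma : ∀ e αi βi d s x → (e * d) * x + (e * (αi * βi + - (αi * βi))) * s ≡ (e * d) * x
              lemma = solve-∀

          lAt-all : ∀ {c i} (c≢i : c ≢ i) r j → lEntry (lAt c≢i (lEntry r c) (lEntry r i)) j ≡ lEntry r j
          lAt-all {c} {i} c≢i (x , y) j = trans (lEntry-at c≢i j _ _) (red-cong
            (≈-trans (value-cong c i j (rep-red _) (rep-red _))
            (≈-trans (≈-reflexive (lemma (e c i) (α c) (β c) (α i) (β i) (α j) (β j) x y))
                     (unit-cancel c≢i (α j * x + β j * y)))))
            where
              lemma : ∀ e αc βc αi βi αj βj x y →
                (e * (αc * βj + - (αj * βc))) * (αi * x + βi * y) + (e * (αj * βi + - (αi * βj))) * (αc * x + βc * y)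
                ≡ (e * (αc * βi + - (αi * βc))) * (αj * x + βj * y)
              lemma = solve-∀

        linear : Array k (Fin n)
        linear = record
          { Row = ℤ × ℤ ; entry = lEntry ; at = lAt ; at-fst = lAt-fst ; at-snd = lAt-snd ; at-all = lAt-all }

        linear-line : ∀ {c i} (c≢i : c ≢ i) j s x → line linear c≢i s x j ≡ red (value c i j (rep s) (rep x))
        linear-line = lEntry-at

        linear-idempotent : Idempotent linear (red (+ 0))
        linear-idempotent = constant-row linear (+ 0 , + 0) λ j →
          cong red (cong₂ _+_ (ℤ.*-zeroʳ (α j)) (ℤ.*-zeroʳ (β j)))

  -- With 36 invertible, the points ∞, 0, …, 4 of the projective line are in general
  -- position: their pairwise determinants divide 36.
  α₆ β₆ : Fin 6 → ℤ
  α₆ zero    = + 0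
  α₆ (suc i) = + 1
  β₆ zero    = + 1
  β₆ (suc i) = + toℕ i

  -- 36 / d for a nonzero determinant d. Since 36 is a square, an inverse h of 6 gives the inverse
  -- h² of 36.
  cofactor : ℤ → ℤ
  cofactor (+ zero)       = + 0
  cofactor (+ suc d)      = + (36 ℕ./ suc d)
  cofactor -[1+ d ]       = - + (36 ℕ./ suc d)

  cofactor-det : ∀ c i → c ≡ i ⊎ cofactor (α₆ c * β₆ i + - (α₆ i * β₆ c)) * (α₆ c * β₆ i + - (α₆ i * β₆ c)) ≡ + 36
  cofactor-det = from-yes (all? {n = 6} λ c → all? {n = 6} λ i → (c ≟ i) ⊎-dec
    (cofactor (α₆ c * β₆ i + - (α₆ i * β₆ c)) * (α₆ c * β₆ i + - (α₆ i * β₆ c)) ℤ.≟ + 36))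

  SixInvertible : (n : ℕ) .{{_ : NonZero n}} → Set
  SixInvertible n = ∃[ h ] _≈_ n (+ 6 * h) (+ 1)

  module _ (n : ℕ) .{{_ : NonZero n}} (invertible : SixInvertible n) where

    private
      h = proj₁ invertible
      6h≈1 = proj₂ invertible

      e : Fin 6 → Fin 6 → ℤ
      e c i = (h * h) * cofactor (α₆ c * β₆ i + - (α₆ i * β₆ c))
      open Linear n α₆ β₆ e

      unit : ∀ {c i} → c ≢ i → _≈_ n (e c i * det c i) (+ 1)
      unit {c} {i} c≢i with cofactor-det c i
      ... | inj₁ c≡i = ⊥-elim (c≢i c≡i)
      ... | inj₂ eq  = ≈-trans n (≈-reflexive n (trans (ℤ.*-assoc (h * h) _ _) (trans (cong ((h * h) *_) eq) (lemma h))))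
                                 (≈-* n 6h≈1 6h≈1)
        where
          lemma : ∀ h → h * h * + 36 ≡ (+ 6 * h) * (+ 6 * h)
          lemma = solve-∀

    linear₆ : Array 6 (Fin n)
    linear₆ = linear unit

    linear₅ : Array 5 (Fin n)
    linear₅ = dropColumn linear₆

    linear₅-idempotent : Idempotent linear₅ (red n (+ 0))
    linear₅-idempotent c≢i j = linear-idempotent unit (c≢i ∘ Fin.suc-injective) (suc j)

  sixInvertible₁ : ∀ a → SixInvertible (suc (6 ℕ.* a))
  sixInvertible₁ a = - + a , by (- + 1) (trans (lemma (+ a)) (cong (λ m → + 1 + - + 1 * (+ 1 + m)) (sym (ℤ.pos-* 6 a))))
    where
      lemma : ∀ a → + 6 * - a ≡ + 1 + - + 1 * (+ 1 + + 6 * a)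
      lemma = solve-∀

  sixInvertible₅ : ∀ a → SixInvertible (5 ℕ.+ 6 ℕ.* a)
  sixInvertible₅ a = + 1 + + a , by (+ 1) (trans (lemma (+ a)) (cong (λ m → + 1 + + 1 * (+ 5 + m)) (sym (ℤ.pos-* 6 a))))
    where
      lemma : ∀ a → + 6 * (+ 1 + a) ≡ + 1 + + 1 * (+ 5 + + 6 * a)
      lemma = solve-∀

-- Small arrays, and the τ-parity of linear arrays over Z₇.

module Ingredients where

  open Signs
  open Parities
  open Arrays
  open LinearArrays
  import Algebra.Properties.CommutativeMonoid.Sum as Sum
  open import Data.Empty using (⊥-elim)
  open import Data.Fin.Base using (Fin; zero; suc)
  open import Data.Fin.Patterns
  import Data.Fin.Properties as Fin
  open import Data.Fin.Properties using (_≟_; any?; all?)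
  open import Data.Integer.Base as ℤ using (ℤ; +_)
  open import Data.Maybe.Base using (Maybe; just; nothing)
  open import Data.Nat.Base as ℕ using (ℕ; zero; suc; NonZero)
  open import Data.Parity.Base as ℙ using (Parity; 0ℙ; 1ℙ; _+_; _*_)
  import Data.Parity.Properties as ℙ
  open import Data.Product.Base using (_×_; _,_; proj₁; proj₂)
  open import Data.Sum.Base using (_⊎_; inj₁; inj₂)
  open import Data.Vec.Base using (Vec; []; _∷_; lookup)
  open import Function.Bundles using (_↔_; Inverse; mk↔ₛ′)
  open import Function.Properties.Inverse using (↔-refl; ↔-sym; ↔-trans)
  open import Relation.Binary.PropositionalEquality
  open import Relation.Nullary using (¬_; ¬?)
  open import Relation.Nullary.Decidable using (_⊎-dec_; _×-dec_; from-yes)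
  open Sum ℙ.+-0-commutativeMonoid using (sum; sum-cong-≗)

  open Array

  module Table {k q : ℕ} (cell : Fin q → Fin q → Fin k → Fin q)
    (solvable : ∀ c i → c ≡ i ⊎ (∀ s x → ∃[ a ] ∃[ b ] (cell a b c ≡ s × cell a b i ≡ x)))
    (unique : ∀ c i → c ≡ i ⊎ (∀ a b a′ b′ → ¬ (cell a b c ≡ cell a′ b′ c × cell a b i ≡ cell a′ b′ i) ⊎ (a ≡ a′ × b ≡ b′)))
    where

    private
      find : ∀ {c i} → c ≢ i → ∀ s x → ∃[ a ] ∃[ b ] (cell a b c ≡ s × cell a b i ≡ x)
      find {c} {i} c≢i with solvable c i
      ... | inj₁ c≡i = ⊥-elim (c≢i c≡i)
      ... | inj₂ f   = f

    table : Array k (Fin q)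
    table = record
      { Row    = Fin q × Fin q
      ; entry  = λ (a , b) → cell a b
      ; at     = λ c≢i s x → let a , b , _ = find c≢i s x in a , b
      ; at-fst = λ c≢i s x → let _ , _ , eq , _ = find c≢i s x in eq
      ; at-snd = λ c≢i s x → let _ , _ , _ , eq = find c≢i s x in eq
      ; at-all = all
      }
      where
        all : ∀ {c i} (c≢i : c ≢ i) r j →
              let a , b , _ = find c≢i (cell (proj₁ r) (proj₂ r) c) (cell (proj₁ r) (proj₂ r) i) in
              cell a b j ≡ cell (proj₁ r) (proj₂ r) j
        all {c} {i} c≢i (a , b) j with find c≢i (cell a b c) (cell a b i) | unique c i
        ... | _ | inj₁ c≡i = ⊥-elim (c≢i c≡i)
        ... | a′ , b′ , eqc , eqi | inj₂ f with f a′ b′ a b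
        ...   | inj₁ ne = ⊥-elim (ne (eqc , eqi))
        ...   | inj₂ (refl , refl) = refl

  -- The field of order 4, with elements 0, 1, ω, ω²; the columns are x, y, x + y, x + ωy, x + ω²y.
  add₄ : Vec (Vec (Fin 4) 4) 4
  add₄ = (0F ∷ 1F ∷ 2F ∷ 3F ∷ []) ∷ (1F ∷ 0F ∷ 3F ∷ 2F ∷ []) ∷ (2F ∷ 3F ∷ 0F ∷ 1F ∷ []) ∷ (3F ∷ 2F ∷ 1F ∷ 0F ∷ []) ∷ []

  timesω timesω² : Vec (Fin 4) 4
  timesω  = 0F ∷ 2F ∷ 3F ∷ 1F ∷ []
  timesω² = 0F ∷ 3F ∷ 1F ∷ 2F ∷ []

  cell₄ : Fin 4 → Fin 4 → Fin 5 → Fin 4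
  cell₄ x y 0F = x
  cell₄ x y 1F = y
  cell₄ x y 2F = lookup (lookup add₄ x) y
  cell₄ x y 3F = lookup (lookup add₄ x) (lookup timesω y)
  cell₄ x y 4F = lookup (lookup add₄ x) (lookup timesω² y)

  abstract
    -- Decided by exhaustive search, and sealed so that uses of `table₄` do not unfold the search.
    -- The disjunct c ≡ i makes the statement decidable over all pairs.
    solvable₄ : ∀ c i → c ≡ i ⊎ (∀ s x → ∃[ a ] ∃[ b ] (cell₄ a b c ≡ s × cell₄ a b i ≡ x))
    solvable₄ = from-yes (all? {n = 5} λ c → all? {n = 5} λ i → (c ≟ i) ⊎-dec
      (all? {n = 4} λ s → all? {n = 4} λ x → any? {n = 4} λ a → any? {n = 4} λ b →
        (cell₄ a b c ≟ s) ×-dec (cell₄ a b i ≟ x)))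

    unique₄ : ∀ c i → c ≡ i ⊎ (∀ a b a′ b′ →
      ¬ (cell₄ a b c ≡ cell₄ a′ b′ c × cell₄ a b i ≡ cell₄ a′ b′ i) ⊎ (a ≡ a′ × b ≡ b′))
    unique₄ = from-yes (all? {n = 5} λ c → all? {n = 5} λ i → (c ≟ i) ⊎-dec
      (all? {n = 4} λ a → all? {n = 4} λ b → all? {n = 4} λ a′ → all? {n = 4} λ b′ →
        (¬? ((cell₄ a b c ≟ cell₄ a′ b′ c) ×-dec (cell₄ a b i ≟ cell₄ a′ b′ i)))
        ⊎-dec ((a ≟ a′) ×-dec (b ≟ b′))))

  open Table cell₄ solvable₄ unique₄ using () renaming (table to table₄)

  table₄-idempotent : Idempotent table₄ 0F
  table₄-idempotent = constant-row table₄ {0F} (0F , 0F) λ { 0F → refl ; 1F → refl ; 2F → refl ; 3F → refl ; 4F → refl }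

  relabel-idempotent : ∀ {k Λ Λ′} (iso : Λ ↔ Λ′) (A : Array k Λ) {z} →
    Idempotent A z → Idempotent (relabel iso A) (Inverse.to iso z)
  relabel-idempotent iso A {z} idem {c} {i} c≢i j = cong to
    (trans (cong₂ (λ s x → line A c≢i s x j) (strictlyInverseʳ z) (strictlyInverseʳ z)) (idem c≢i j))
    where open Inverse iso

  Fin↔Maybe : ∀ {n} → Fin (suc n) ↔ Maybe (Fin n)
  Fin↔Maybe = mk↔ₛ′ (λ { zero → nothing ; (suc i) → just i }) (λ { nothing → zero ; (just i) → suc i })
    (λ { nothing → refl ; (just i) → refl }) (λ { zero → refl ; (suc i) → refl })

  record Weight (m : ℕ) : Set₁ where
    field
      array  : Array 5 (Fin m)
      array⁺ : Array 5 (Maybe (Fin m))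
      array⁺-idempotent : Idempotent array⁺ nothing

  weight₄ : Weight 4
  weight₄ = record
    { array  = table₄
    ; array⁺ = relabel Fin↔Maybe (linear₅ 5 (sixInvertible₅ 0))
    ; array⁺-idempotent = relabel-idempotent Fin↔Maybe (linear₅ 5 (sixInvertible₅ 0)) (linear₅-idempotent 5 (sixInvertible₅ 0))
    }

  product₂₀ : Array 5 (Fin 4 × Fin 5)
  product₂₀ = product table₄ (λ _ _ → linear₅ 5 (sixInvertible₅ 0))

  weight₁₉ : Weight 19
  weight₁₉ = record
    { array  = linear₅ 19 (sixInvertible₁ 3)
    ; array⁺ = relabel iso product₂₀
    ; array⁺-idempotent = relabel-idempotent iso product₂₀
        (product-idempotent table₄ (λ _ _ → linear₅ 5 (sixInvertible₅ 0)) {0F} {0F} table₄-idempotent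
           (linear₅-idempotent 5 (sixInvertible₅ 0)))
    }
    where
      iso : (Fin 4 × Fin 5) ↔ Maybe (Fin 19)
      iso = ↔-trans (↔-sym (Fin.*↔× {4} {5})) Fin↔Maybe

  red-injective : ∀ n .{{_ : NonZero n}} {a b} → red n a ≡ red n b → _≈_ n a b
  red-injective n {a} {b} eq = ≈-trans n (≈-sym n (rep-red n a))
    (≈-trans n (≈-reflexive n (cong (rep n) eq)) (rep-red n b))

  -- By Zolotarev's lemma this is the quadratic character modulo 7 for a ≠ 0; the value at 0 is
  -- junk.
  character : Fin 7 → Parity
  character a = sgn λ z → red 7 (rep 7 a ℤ.* rep 7 z)

  abstract
    -- A translation of Z₇ is trivial or a 7-cycle, hence even.
    sgn-affine : ∀ a b → sgn (λ z → red 7 (rep 7 a ℤ.* rep 7 z ℤ.+ rep 7 b)) ≡ character a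
    sgn-affine = from-yes (all? {n = 7} λ a → all? {n = 7} λ b →
      sgn {7} (λ z → red 7 (rep 7 a ℤ.* rep 7 z ℤ.+ rep 7 b)) ℙ.≟ character a)

  module _ {k : ℕ} (α β : Fin (suc (suc k)) → ℤ) (e : Fin (suc (suc k)) → Fin (suc (suc k)) → ℤ) where
    open Linear 7 α β e

    -- Every ρ_s is affine with the same multiplier det c j / det c i, and seven equal parities add
    -- up to one of them.
    τ-linear : (unit : ∀ {c i} → c ≢ i → _≈_ 7 (e c i ℤ.* det c i) (+ 1)) (t : Triple (suc (suc k))) →
      τ (toOA (↔-refl {A = Fin 7}) (linear unit)) t ≡ character (red 7 (e (Triple.c t) (Triple.i t) ℤ.* det (Triple.c t) (Triple.j t)))
    τ-linear unit t = trans (sum-cong-≗ {7} each) (seven (character (red 7 u)))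
      where
        open Triple t
        A = toOA (↔-refl {A = Fin 7}) (linear unit)
        u = e c i ℤ.* det c j
        w = e c i ℤ.* det j i
        seven : ∀ p → sum {7} (λ _ → p) ≡ p
        seven 0ℙ = refl
        seven 1ℙ = refl
        each : ∀ s → π (ρ A c≢i c≢j s) ≡ character (red 7 u)
        each s = trans (π≡sgn (ρ A c≢i c≢j s)) (trans
          (sgn-cong {7} λ z → trans (ρ-to-toOA (↔-refl {A = Fin 7}) (linear unit) c≢i j s z)
            (trans (linear-line unit c≢i j s z)
              (red-cong 7 (≈-+ 7 (≈-* 7 (≈-sym 7 (rep-red 7 u)) (≈-reflexive 7 {rep 7 z} refl))
                (≈-sym 7 (rep-red 7 (w ℤ.* rep 7 s)))))))
          (sgn-affine (red 7 u) (red 7 (w ℤ.* rep 7 s))))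

-- Changing one value φ(c,i) at a time.

module Toggles where

  open Signs
  open Parities
  open Arrays
  open LinearArrays
  open Ingredients
  import Algebra.Properties.CommutativeMonoid.Sum as Sum
  open import Data.Empty using (⊥-elim)
  open import Data.Fin.Base using (Fin; zero; suc)
  open import Data.Fin.Patterns
  open import Data.Fin.Permutation using (Permutation′; _⟨$⟩ʳ_; transpose; _∘ₚ_)
  open import Data.Fin.Properties using (_≟_; all?)
  open import Data.Integer.Base as ℤ using (ℤ; -_)
  open import Data.Nat.Base as ℕ using (ℕ; zero; suc)
  open import Data.Parity.Base as ℙ using (Parity; 0ℙ; 1ℙ; _+_; _*_)
  import Data.Parity.Properties as ℙ
  open import Data.Product.Base using (_×_; _,_)
  open import Data.Sum.Base using (_⊎_; inj₁; inj₂)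
  open import Data.Vec.Base using ([]; _∷_; lookup)
  open import Function.Base using (_∘_; case_of_)
  open import Function.Bundles using (_↔_; Inverse)
  open import Function.Properties.Inverse using (↔-refl)
  open import Relation.Binary.PropositionalEquality
  open import Relation.Nullary using (¬_; does)
  open import Relation.Nullary.Decidable using (_⊎-dec_; from-yes)
  open Sum ℙ.+-0-commutativeMonoid using (sum; sum-cong-≗; ∑-distrib-+; sum-replicate-zero)

  open Array

  -- The columns α x + β y of two linear arrays over Z₇ which differ only in column 0; among the
  -- determinants of pairs of columns, only that of {0, 1} changes its quadratic character.
  α₇ β₇ : Parity → Fin 5 → ℤ
  α₇ 1ℙ 0F = ℤ.+ 3
  α₇ _  _  = ℤ.+ 1
  β₇ 0ℙ 0F = ℤ.+ 0
  β₇ 1ℙ 0F = ℤ.+ 3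
  β₇ _  1F = ℤ.+ 2
  β₇ _  2F = ℤ.+ 3
  β₇ _  3F = ℤ.+ 4
  β₇ _  4F = ℤ.+ 5

  det₇ : Parity → Fin 5 → Fin 5 → ℤ
  det₇ p c i = α₇ p c ℤ.* β₇ p i ℤ.+ - (α₇ p i ℤ.* β₇ p c)

  pair₀₁ : Fin 5 → Fin 5 → Parity
  pair₀₁ 0F 1F = 1ℙ
  pair₀₁ 1F 0F = 1ℙ
  pair₀₁ _  _  = 0ℙ

  abstract
    -- Fermat: d⁵ inverts d modulo 7.
    inv₇ : Parity → Fin 5 → Fin 5 → ℤ
    inv₇ p c i = det₇ p c i ℤ.^ 5

    inv₇-det₇ : ∀ p c i → c ≡ i ⊎ red 7 (inv₇ p c i ℤ.* det₇ p c i) ≡ red 7 (ℤ.+ 1)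
    inv₇-det₇ 0ℙ = from-yes (all? {n = 5} λ c → all? {n = 5} λ i → (c ≟ i) ⊎-dec
      (red 7 (inv₇ 0ℙ c i ℤ.* det₇ 0ℙ c i) ≟ red 7 (ℤ.+ 1)))
    inv₇-det₇ 1ℙ = from-yes (all? {n = 5} λ c → all? {n = 5} λ i → (c ≟ i) ⊎-dec
      (red 7 (inv₇ 1ℙ c i ℤ.* det₇ 1ℙ c i) ≟ red 7 (ℤ.+ 1)))

  multiplier₇ : Parity → Fin 5 → Fin 5 → Fin 5 → Fin 7
  multiplier₇ p c i j = red 7 (inv₇ p c i ℤ.* det₇ p c j)

  abstract
    -- The character of det c j / det c i is the sum of the characters of the two determinants, and
    -- only the one of {0, 1} changes.
    character-change : ∀ c i j → (c ≡ i ⊎ c ≡ j ⊎ i ≡ j) ⊎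
      character (multiplier₇ 0ℙ c i j) + character (multiplier₇ 1ℙ c i j) ≡ pair₀₁ c i + pair₀₁ c j
    character-change = from-yes (all? {n = 5} λ c → all? {n = 5} λ i → all? {n = 5} λ j →
      ((c ≟ i) ⊎-dec ((c ≟ j) ⊎-dec (i ≟ j))) ⊎-dec
      (character (multiplier₇ 0ℙ c i j) + character (multiplier₇ 1ℙ c i j) ℙ.≟ pair₀₁ c i + pair₀₁ c j))

  -- Ordered by the larger column, so that the pairs within the first k columns form an initial
  -- segment.
  ends : Fin 10 → Fin 5 × Fin 5
  ends = lookup ((0F , 1F) ∷ (0F , 2F) ∷ (1F , 2F) ∷ (0F , 3F) ∷ (1F , 3F) ∷ (2F , 3F)
               ∷ (0F , 4F) ∷ (1F , 4F) ∷ (2F , 4F) ∷ (3F , 4F) ∷ [])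

  -- Junk on the diagonal.
  edge : Fin 5 → Fin 5 → Fin 10
  edge c i = lookup (lookup
    ( (0F ∷ 0F ∷ 1F ∷ 3F ∷ 6F ∷ [])
    ∷ (0F ∷ 0F ∷ 2F ∷ 4F ∷ 7F ∷ [])
    ∷ (1F ∷ 2F ∷ 0F ∷ 5F ∷ 8F ∷ [])
    ∷ (3F ∷ 4F ∷ 5F ∷ 0F ∷ 9F ∷ [])
    ∷ (6F ∷ 7F ∷ 8F ∷ 9F ∷ 0F ∷ []) ∷ []) c) i

  -- Sends the ends c < i of ε to 0 and 1: i is neither 0 nor c, so the first transposition fixes i
  -- and the second fixes 0.
  moveEnds : Fin 10 → Permutation′ 5
  moveEnds ε = let c , i = ends ε in transpose 0F c ∘ₚ transpose 1F i

  module _ (ε : Fin 10) where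

    move : Fin 5 → Fin 5
    move = moveEnds ε ⟨$⟩ʳ_

    move-≢ : ∀ {c i} → c ≢ i → move c ≢ move i
    move-≢ c≢i = c≢i ∘ ⟨$⟩ʳ-injective (moveEnds ε)

    module Toggled (p : Parity) = Linear 7 (α₇ p ∘ move) (β₇ p ∘ move) (λ c i → inv₇ p (move c) (move i))

    private
      unit : ∀ p {c i} → c ≢ i → _≈_ 7 (inv₇ p (move c) (move i) ℤ.* det₇ p (move c) (move i)) (ℤ.+ 1)
      unit p {c} {i} c≢i with inv₇-det₇ p (move c) (move i)
      ... | inj₁ eq = ⊥-elim (move-≢ c≢i eq)
      ... | inj₂ eq = red-injective 7 {inv₇ p (move c) (move i) ℤ.* det₇ p (move c) (move i)} {ℤ.+ 1} eq

    toggled : Parity → Array 5 (Fin 7)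
    toggled p = Toggled.linear p (unit p)

    toggledOA : Parity → OA 5 7
    toggledOA p = toOA (↔-refl {A = Fin 7}) (toggled p)

    change : Fin 5 → Fin 5 → Parity
    change c i = pair₀₁ (move c) (move i)

    τ-toggled₁ : ∀ p t → let open Triple t in
      τ (toggledOA p) t ≡ character (red 7 (inv₇ p (move c) (move i) ℤ.* Toggled.det p c j))
    τ-toggled₁ p = τ-linear (α₇ p ∘ move) (β₇ p ∘ move) (λ c i → inv₇ p (move c) (move i)) (unit p)

    τ-toggled : ∀ t → let open Triple t in
      τ (toggledOA 0ℙ) t + τ (toggledOA 1ℙ) t ≡ change c i + change c j
    τ-toggled t = trans
      (cong₂ _+_ (τ-toggled₁ 0ℙ t) (τ-toggled₁ 1ℙ t))
      (distinct (character-change (move c) (move i) (move j)))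
      where
        open Triple t
        distinct : ∀ {P : Set} → (move c ≡ move i ⊎ move c ≡ move j ⊎ move i ≡ move j) ⊎ P → P
        distinct (inj₁ (inj₁ eq))        = ⊥-elim (move-≢ c≢i eq)
        distinct (inj₁ (inj₂ (inj₁ eq))) = ⊥-elim (move-≢ c≢j eq)
        distinct (inj₁ (inj₂ (inj₂ eq))) = ⊥-elim (move-≢ i≢j eq)
        distinct (inj₂ p)                = p

    τ-toggled₂ : ∀ p q t → let open Triple t in
      τ (toggledOA p) t + τ (toggledOA q) t ≡ (p + q) * (change c i + change c j)
    τ-toggled₂ 0ℙ 0ℙ t = ℙ.p+p≡0ℙ (τ (toggledOA 0ℙ) t)
    τ-toggled₂ 0ℙ 1ℙ t = τ-toggled t
    τ-toggled₂ 1ℙ 0ℙ t = trans (ℙ.+-comm (τ (toggledOA 1ℙ) t) (τ (toggledOA 0ℙ) t)) (τ-toggled t)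
    τ-toggled₂ 1ℙ 1ℙ t = ℙ.p+p≡0ℙ (τ (toggledOA 1ℙ) t)

  abstract
    change-edge : ∀ c i → c ≡ i ⊎ (∀ ε → change ε c i ≡ 𝟙 (does (ε ≟ edge c i)))
    change-edge = from-yes (all? {n = 5} λ c → all? {n = 5} λ i → (c ≟ i) ⊎-dec
      (all? {n = 10} λ ε → change ε c i ℙ.≟ 𝟙 (does (ε ≟ edge c i))))

  sum-select : ∀ {n} (h : Fin n → Parity) x → sum (λ ε → h ε * 𝟙 (does (ε ≟ x))) ≡ h x
  sum-select {suc n} h zero = trans (cong₂ _+_ (ℙ.*-comm (h zero) 1ℙ)
    (trans (sum-cong-≗ {n} λ ε → ℙ.*-zeroʳ (h (suc ε))) (sum-replicate-zero n))) (ℙ.+-identityʳ (h zero))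
  sum-select {suc n} h (suc x) = cong₂ _+_ (ℙ.*-zeroʳ (h zero)) (sum-select (h ∘ suc) x)

  -- Telescopes along the path that changes one coordinate at a time.
  accumulate : ∀ {n} (Φ : (Fin n → Parity) → Parity) (w : Fin n → Parity) →
    (∀ f g → f ≗ g → Φ f ≡ Φ g) →
    (∀ f g ε → (∀ ε′ → ε′ ≢ ε → f ε′ ≡ g ε′) → Φ f + Φ g ≡ (f ε + g ε) * w ε) →
    ∀ f g → Φ f + Φ g ≡ sum λ ε → (f ε + g ε) * w ε
  accumulate {zero}  Φ w ext step f g = trans (cong (_+ Φ g) (ext f g λ ())) (ℙ.p+p≡0ℙ (Φ g))
  accumulate {suc n} Φ w ext step f g = begin
    Φ f + Φ g
      ≡⟨ cong (Φ f +_) (cong (_+ Φ g) (ℙ.p+p≡0ℙ (Φ m))) ⟨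
    Φ f + ((Φ m + Φ m) + Φ g)
      ≡⟨ cong (Φ f +_) (ℙ.+-assoc (Φ m) (Φ m) (Φ g)) ⟩
    Φ f + (Φ m + (Φ m + Φ g))
      ≡⟨ ℙ.+-assoc (Φ f) (Φ m) _ ⟨
    (Φ f + Φ m) + (Φ m + Φ g)
      ≡⟨ cong₂ _+_ (step f m zero λ { zero 0≢0 → ⊥-elim (0≢0 refl) ; (suc ε) _ → refl })
           (trans (cong (Φ m +_) (ext g (cons (g ∘ suc)) λ { zero → refl ; (suc ε) → refl }))
             (accumulate (Φ ∘ cons) (w ∘ suc)
               (λ f′ g′ f′≗g′ → ext (cons f′) (cons g′) λ { zero → refl ; (suc ε) → f′≗g′ ε })
               (λ f′ g′ ε agree → step (cons f′) (cons g′) (suc ε)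
                 λ { zero _ → refl ; (suc ε′) ε′≢ε → agree ε′ (ε′≢ε ∘ cong suc) })
               (f ∘ suc) (g ∘ suc))) ⟩
    ((f zero + g zero) * w zero) + sum (λ ε → (f (suc ε) + g (suc ε)) * w (suc ε)) ∎
    where
      open ≡-Reasoning
      cons : (Fin n → Parity) → Fin (suc n) → Parity
      cons h zero    = g zero
      cons h (suc ε) = h ε
      -- The first stop on the path: coordinate 0 already has its value in g, the others still those
      -- in f.
      m = cons (f ∘ suc)

  module Flexible {w′ v m n : ℕ} (W : Array 5 (Fin 10 ⊎ Fin w′)) (ω : Weight m)
    (T : Array 6 (((Fin 10 ⊎ Fin w′) × Fin 7) ⊎ Fin v))
    (iso : (((((Fin 10 ⊎ Fin w′) × Fin 7) ⊎ Fin v) × Fin m) ⊎ ((Fin 10 ⊎ Fin w′) × Fin 7)) ↔ Fin n) where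

    open Weight ω renaming (array to M; array⁺ to M⁺)
    open Wilson T M M⁺ array⁺-idempotent
    open Inverse iso

    -- The row of `W` starting with ε, 0 carries the toggle of the pair ε. Different ε give
    -- different rows, so the ten subarrays are replaced independently; all other rows get one
    -- arbitrary array of order 7.
    fill : (Fin 10 → Parity) → Fin 10 ⊎ Fin w′ → Fin 10 ⊎ Fin w′ → Array 5 (Fin 7)
    fill f (inj₁ ε) (inj₁ zero) = toggled ε (f ε)
    fill f _        _           = toggled 0F 0ℙ

    flexible : (Fin 10 → Parity) → Array 5 Symbol
    flexible f = wilson (product W (fill f))

    flexibleOA : (Fin 10 → Parity) → OA 5 n
    flexibleOA f = toOA iso (flexible f)

    module _ (f g : Fin 10 → Parity) (ε : Fin 10) (agree : ∀ ε′ → ε′ ≢ ε → f ε′ ≡ g ε′) where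

      private
        0≢1 : _≢_ {A = Fin 5} 0F 1F
        0≢1 ()

        row : Row W
        row = at W 0≢1 (inj₁ ε) (inj₁ zero)

        -- The seven symbols of the subarray vary with the column, as the entries of `row` do.
        ι : Fin 5 → Fin 7 → Fin n
        ι c y = to (inj₂ (entry W row c , y))

        ι-injective : ∀ c {x y} → ι c x ≡ ι c y → x ≡ y
        ι-injective c {x} {y} eq = case trans (sym (strictlyInverseʳ _)) (trans (cong from eq) (strictlyInverseʳ _)) of λ { refl → refl }

        on : ∀ h {c i} (c≢i : c ≢ i) j x y →
             ρ-to (flexibleOA h) c≢i j (ι c x) (ι i y) ≡ ι j (ρ-to (toggledOA ε (h ε)) c≢i j x y)
        on h {c} {i} c≢i j x y = begin
          ρ-to (flexibleOA h) c≢i j (ι c x) (ι i y)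
            ≡⟨ ρ-to-toOA iso (flexible h) c≢i j (ι c x) (ι i y) ⟩
          to (line (flexible h) c≢i (from (ι c x)) (from (ι i y)) j)
            ≡⟨ cong to (cong₂ (λ s x → line (flexible h) c≢i s x j) (strictlyInverseʳ _) (strictlyInverseʳ _)) ⟩
          to (inj₂ (line (product W (fill h)) c≢i (entry W row c , x) (entry W row i , y) j))
            ≡⟨ cong (λ z → to (inj₂ z)) (cong₂ _,_ (at-all W c≢i row j) (trans
                 (cong₂ (λ p q → line (fill h p q) c≢i x y j)
                   (trans (at-all W c≢i row 0F) (at-fst W 0≢1 _ _))
                   (trans (at-all W c≢i row 1F) (at-snd W 0≢1 _ _)))
                 (sym (ρ-to-toOA (↔-refl {A = Fin 7}) (toggled ε (h ε)) c≢i j x y)))) ⟩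
          ι j (ρ-to (toggledOA ε (h ε)) c≢i j x y) ∎
          where open ≡-Reasoning

        fill-agree : ∀ p q → ¬ (p ≡ inj₁ ε × q ≡ inj₁ zero) → fill f p q ≡ fill g p q
        fill-agree (inj₁ ε′) (inj₁ zero) ne = cong (toggled ε′) (agree ε′ λ ε′≡ε → ne (cong inj₁ ε′≡ε , refl))
        fill-agree (inj₁ ε′) (inj₁ (suc _)) ne = refl
        fill-agree (inj₁ ε′) (inj₂ _) ne = refl
        fill-agree (inj₂ _) _ ne = refl

        inHole : ∀ {c i} (c≢i : c ≢ i) g′ h′ →
          line W c≢i g′ h′ 0F ≡ inj₁ ε → line W c≢i g′ h′ 1F ≡ inj₁ zero → g′ ≡ entry W row c × h′ ≡ entry W row i
        inHole c≢i g′ h′ eq₀ eq₁ =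
          trans (sym (at-fst W c≢i g′ h′)) (sym (at-row W 0≢1 (at W c≢i g′ h′) _ eq₀ eq₁)) ,
          trans (sym (at-snd W c≢i g′ h′)) (sym (at-row W 0≢1 (at W c≢i g′ h′) _ eq₀ eq₁))

        -- Unless both symbols lie in the hole, `line-outside` applies. Within the hole the fillings
        -- differ only over `row`, which `inHole` recognises by its first two entries.
        off : ∀ {c i} (c≢i : c ≢ i) j s x → ¬ (∃[ s₀ ] ∃[ x₀ ] (s ≡ inj₂ (entry W row c , s₀) × x ≡ inj₂ (entry W row i , x₀))) →
              line (flexible f) c≢i s x j ≡ line (flexible g) c≢i s x j
        off c≢i j (inj₂ (g′ , a)) (inj₂ (h′ , b)) ∉hole = cong (λ F → inj₂ (line W c≢i g′ h′ j , line F c≢i a b j))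
          (fill-agree (line W c≢i g′ h′ 0F) (line W c≢i g′ h′ 1F)
            λ (eq₀ , eq₁) → let g≡ , h≡ = inHole c≢i g′ h′ eq₀ eq₁ in
              ∉hole (a , b , cong (λ z → inj₂ (z , a)) g≡ , cong (λ z → inj₂ (z , b)) h≡))
        off c≢i j s@(inj₁ _) x _ = line-outside (product W (fill f)) (product W (fill g)) c≢i j s x λ ()
        off c≢i j s@(inj₂ _) x@(inj₁ _) _ = line-outside (product W (fill f)) (product W (fill g)) c≢i j s x λ ()

        off′ : ∀ {c i} (c≢i : c ≢ i) j s x → ¬ (∃[ s₀ ] ∃[ x₀ ] (s ≡ ι c s₀ × x ≡ ι i x₀)) →
               ρ-to (flexibleOA f) c≢i j s x ≡ ρ-to (flexibleOA g) c≢i j s x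
        off′ c≢i j s x ∉hole = trans (ρ-to-toOA iso (flexible f) c≢i j s x) (trans
          (cong to (off c≢i j (from s) (from x) λ (s₀ , x₀ , s≡ , x≡) → ∉hole
            (s₀ , x₀ , trans (sym (strictlyInverseˡ s)) (cong to s≡) , trans (sym (strictlyInverseˡ x)) (cong to x≡))))
          (sym (ρ-to-toOA iso (flexible g) c≢i j s x)))

      τ-step : ∀ t → let open Triple t in
        τ (flexibleOA f) t + τ (flexibleOA g) t ≡ (f ε + g ε) * (change ε c i + change ε c j)
      τ-step t = trans
        (τ-trade (flexibleOA f) (flexibleOA g) (toggledOA ε (f ε)) (toggledOA ε (g ε)) ι ι-injective (on f) (on g) off′ t)
        (τ-toggled₂ ε (f ε) (g ε) t)

    τ-flexible : ∀ f g t → let open Triple t in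
      τ (flexibleOA f) t + τ (flexibleOA g) t ≡ (f (edge c i) + g (edge c i)) + (f (edge c j) + g (edge c j))
    τ-flexible f g t = begin
      τ (flexibleOA f) t + τ (flexibleOA g) t
        ≡⟨ accumulate (λ f → τ (flexibleOA f) t) (λ ε → change ε c i + change ε c j) ext (λ f g ε agree → τ-step f g ε agree t) f g ⟩
      sum (λ ε → (f ε + g ε) * (change ε c i + change ε c j))
        ≡⟨ sum-cong-≗ {10} (λ ε → trans (cong ((f ε + g ε) *_) (cong₂ _+_ (change≡ c≢i ε) (change≡ c≢j ε)))
             (ℙ.*-distribˡ-+ (f ε + g ε) (𝟙 (does (ε ≟ edge c i))) (𝟙 (does (ε ≟ edge c j))))) ⟩
      sum (λ ε → ((f ε + g ε) * 𝟙 (does (ε ≟ edge c i))) + ((f ε + g ε) * 𝟙 (does (ε ≟ edge c j))))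
        ≡⟨ ∑-distrib-+ {10} (λ ε → (f ε + g ε) * 𝟙 (does (ε ≟ edge c i))) (λ ε → (f ε + g ε) * 𝟙 (does (ε ≟ edge c j))) ⟩
      sum (λ ε → (f ε + g ε) * 𝟙 (does (ε ≟ edge c i))) + sum (λ ε → (f ε + g ε) * 𝟙 (does (ε ≟ edge c j)))
        ≡⟨ cong₂ _+_ (sum-select (λ ε → f ε + g ε) (edge c i)) (sum-select (λ ε → f ε + g ε) (edge c j)) ⟩
      (f (edge c i) + g (edge c i)) + (f (edge c j) + g (edge c j)) ∎
      where
        open ≡-Reasoning
        open Triple t
        change≡ : ∀ {c i} → c ≢ i → ∀ ε → change ε c i ≡ 𝟙 (does (ε ≟ edge c i))
        change≡ {c} {i} c≢i ε with change-edge c i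
        ... | inj₁ c≡i = ⊥-elim (c≢i c≡i)
        ... | inj₂ eq  = eq ε
        ext : ∀ f g → f ≗ g → τ (flexibleOA f) t ≡ τ (flexibleOA g) t
        -- Pointwise equal functions count as a step at coordinate zero that changes nothing.
        ext f g f≗g = +-≡0⇒≡ (trans (τ-step f g zero (λ ε _ → f≗g ε) t)
          (cong (_* (change zero c i + change zero c j)) (trans (cong (_+ g zero) (f≗g zero)) (ℙ.p+p≡0ℙ (g zero)))))

-- Arrays of every large order.

module Existence where

  open Signs
  open Parities
  open Arrays
  open LinearArrays
  open Ingredients
  open Toggles
  open import Data.Empty using (⊥-elim)
  open import Data.Fin.Base using (Fin; suc; toℕ; fromℕ<)
  open import Data.Fin.Patterns using (0F; 1F)
  import Data.Fin.Properties as Fin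
  open import Data.Fin.Properties using (any?; all?)
  import Data.Integer.Base as ℤ
  import Data.Integer.Properties as ℤ
  import Data.Integer.Tactic.RingSolver as ℤ
  open import Data.Nat.Base using (ℕ; suc; NonZero; _+_; _*_; _∸_; _≤_; _≥_; _%_; _/_)
  open import Data.Nat.Divisibility using (divides-refl)
  open import Data.Nat.DivMod using (m≡m%n+[m/n]*n; m%n<n; m*n/n≡m; m/n≤m; /-monoˡ-≤; m∣n⇒o%n%m≡o%m)
  import Data.Nat.Properties as ℕ
  open import Data.Nat.Tactic.RingSolver using (solve-∀)
  open import Data.Parity.Base as ℙ using (Parity)
  open import Data.Product.Base using (_×_; _,_)
  open import Data.Product.Function.NonDependent.Propositional using (_×-↔_)
  open import Data.Sum.Base using (_⊎_; inj₁; inj₂)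
  open import Data.Sum.Function.Propositional using (_⊎-↔_)
  open import Function.Bundles using (_↔_)
  open import Function.Properties.Inverse using (↔-refl; ↔-sym; ↔-trans)
  open import Relation.Binary.PropositionalEquality
  open import Relation.Nullary using (yes; no)
  open import Relation.Nullary.Decidable using (_⊎-dec_; _×-dec_; from-yes)

  -- 1 or 5, the residues prime to 6; the outer `suc` makes the orders visibly nonzero.
  unit₆ : Fin 2 → ℕ
  unit₆ ε = suc (4 * toℕ ε)

  sixInvertible : ∀ ε a → SixInvertible (unit₆ ε + 6 * a)
  sixInvertible 0F a = sixInvertible₁ a
  sixInvertible 1F a = sixInvertible₅ a

  -- The order w = 12 + unit₆ ε + 6 b is split as 10 + w-10, one symbol for each of the ten holes.
  w-10 : Fin 2 → ℕ → ℕ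
  w-10 ε b = 2 + (unit₆ ε + 6 * b)

  sixInvertible₁₂ : ∀ ε b → SixInvertible (10 + w-10 ε b)
  sixInvertible₁₂ 0F b = ℤ.- (ℤ.+ 2 ℤ.+ ℤ.+ b) , by (ℤ.- ℤ.+ 1) (trans (lemma (ℤ.+ b))
    (cong (λ m → ℤ.+ 1 ℤ.+ ℤ.- ℤ.+ 1 ℤ.* (ℤ.+ 13 ℤ.+ m)) (sym (ℤ.pos-* 6 b))))
    where
      lemma : ∀ b → ℤ.+ 6 ℤ.* ℤ.- (ℤ.+ 2 ℤ.+ b) ≡ ℤ.+ 1 ℤ.+ ℤ.- ℤ.+ 1 ℤ.* (ℤ.+ 13 ℤ.+ ℤ.+ 6 ℤ.* b)
      lemma = ℤ.solve-∀
  sixInvertible₁₂ 1F b = ℤ.+ 3 ℤ.+ ℤ.+ b , by (ℤ.+ 1) (trans (lemma (ℤ.+ b))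
    (cong (λ m → ℤ.+ 1 ℤ.+ ℤ.+ 1 ℤ.* (ℤ.+ 17 ℤ.+ m)) (sym (ℤ.pos-* 6 b))))
    where
      lemma : ∀ b → ℤ.+ 6 ℤ.* (ℤ.+ 3 ℤ.+ b) ≡ ℤ.+ 1 ℤ.+ ℤ.+ 1 ℤ.* (ℤ.+ 17 ℤ.+ ℤ.+ 6 ℤ.* b)
      lemma = ℤ.solve-∀

  holeOrder : Fin 2 → ℕ → ℕ
  holeOrder ε b = (10 + w-10 ε b) * 7

  -- The order n for a = 0. Each step of a adds 6 m, so only the residue modulo 6 m has to be
  -- matched.
  smallest : ℕ → Fin 2 → Fin 2 → ℕ → ℕ
  smallest m δ ε b = unit₆ δ * m + holeOrder ε b

  -- `holeOrder` grows by 42 with b, so b matters only modulo m. For m = 4 and m = 19 the bound 2000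
  -- is generous: the extreme case is 5 · 19 + 2 · 875 = 1845.
  Solution : (m : ℕ) .{{_ : NonZero (6 * m)}} → ℕ → Set
  Solution m r = ∃[ δ ] ∃[ ε ] ∃[ b ]
    (smallest m δ ε (toℕ {m} b) % (6 * m) ≡ r × smallest m δ ε (toℕ b) + holeOrder ε (toℕ b) ≤ 2000)

  abstract
    -- For odd r, the odd numbers r - 4 and r - 20 differ by 16, so one of them is prime to 6; as 7
    -- is invertible modulo 24, it is 7 w for some w prime to 6.
    solution₄ : ∀ (r : Fin 24) → toℕ r % 2 ≡ 0 ⊎ Solution 4 (toℕ r)
    solution₄ = from-yes (all? {n = 24} λ r → (toℕ r % 2 ℕ.≟ 0) ⊎-dec
      (any? {n = 2} λ δ → any? {n = 2} λ ε → any? {n = 4} λ b →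
        (smallest 4 δ ε (toℕ b) % 24 ℕ.≟ toℕ r) ×-dec (smallest 4 δ ε (toℕ b) + holeOrder ε (toℕ b) ℕ.≤? 2000)))

    -- The same for even r, with r - 19 and r - 95, which differ by 76, and 7 invertible modulo 114.
    solution₁₉ : ∀ (r : Fin 114) → toℕ r % 2 ≡ 1 ⊎ Solution 19 (toℕ r)
    solution₁₉ = from-yes (all? {n = 114} λ r → (toℕ r % 2 ℕ.≟ 1) ⊎-dec
      (any? {n = 2} λ δ → any? {n = 2} λ ε → any? {n = 19} λ b →
        (smallest 19 δ ε (toℕ b) % 114 ℕ.≟ toℕ r) ×-dec (smallest 19 δ ε (toℕ b) + holeOrder ε (toℕ b) ℕ.≤? 2000)))

  -- n = t m + 7 w, where t = unit₆ δ + 6 a and w = 10 + w-10 ε b are coprime to 6 and 7 w ≤ t.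
  record Decomposition (n : ℕ) : Set₁ where
    field
      m       : ℕ
      weight  : Weight m
      δ ε     : Fin 2
      a b v   : ℕ
      t-split : unit₆ δ + 6 * a ≡ holeOrder ε b + v
      n-split : n ≡ (unit₆ δ + 6 * a) * m + holeOrder ε b

  -- As s ≡ n modulo 6 m, the excess n - s is 6 m times the difference h - q of the quotients, which
  -- becomes a. From s + u ≤ 2000 ≤ h and q ≤ s follows u ≤ a ≤ t, so the truncated column has room
  -- for the hole.
  solution⇒decomposition : ∀ {m} .{{_ : NonZero (6 * m)}} → Weight m → ∀ n → n ≥ 2000 * (6 * m) →
    Solution m (n % (6 * m)) → Decomposition n
  solution⇒decomposition {m} ω n n≥ (δ , ε , b , s≡n , s+u≤2000) = record
    { m = m ; weight = ω ; δ = δ ; ε = ε ; a = h ∸ q ; b = toℕ b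
    ; v = unit₆ δ + 6 * (h ∸ q) ∸ u
    ; t-split = sym (ℕ.m+[n∸m]≡n u≤t)
    ; n-split = n≡
    }
    where
      s = smallest m δ ε (toℕ b)
      u = holeOrder ε (toℕ b)
      h = n / (6 * m)
      q = s / (6 * m)
      s+u≤h : s + u ≤ h
      s+u≤h = ℕ.≤-trans s+u≤2000 (subst (_≤ h) (m*n/n≡m 2000 (6 * m)) (/-monoˡ-≤ (6 * m) n≥))
      q≤h : q ≤ h
      q≤h = ℕ.≤-trans (m/n≤m s (6 * m)) (ℕ.≤-trans (ℕ.m≤m+n s u) s+u≤h)
      u≤h∸q : u ≤ h ∸ q
      u≤h∸q = ℕ.m+n≤o⇒m≤o∸n u (ℕ.≤-trans (ℕ.+-monoʳ-≤ u (m/n≤m s (6 * m))) (subst (_≤ h) (ℕ.+-comm s u) s+u≤h))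
      u≤t : u ≤ unit₆ δ + 6 * (h ∸ q)
      u≤t = ℕ.≤-trans u≤h∸q (ℕ.≤-trans (ℕ.m≤n*m (h ∸ q) 6) (ℕ.m≤n+m (6 * (h ∸ q)) (unit₆ δ)))
      open ≡-Reasoning
      regroup : ∀ x m u y → (x * m + u) + y * (6 * m) ≡ (x + 6 * y) * m + u
      regroup = solve-∀
      n≡ : n ≡ (unit₆ δ + 6 * (h ∸ q)) * m + u
      n≡ = begin
        n                                                   ≡⟨ m≡m%n+[m/n]*n n (6 * m) ⟩
        n % (6 * m) + h * (6 * m)                           ≡⟨ cong₂ (λ r k → r + k * (6 * m)) (sym s≡n) (sym (ℕ.m+[n∸m]≡n q≤h)) ⟩
        s % (6 * m) + (q + (h ∸ q)) * (6 * m)               ≡⟨ cong (s % (6 * m) +_) (ℕ.*-distribʳ-+ (6 * m) q (h ∸ q)) ⟩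
        s % (6 * m) + (q * (6 * m) + (h ∸ q) * (6 * m))     ≡⟨ ℕ.+-assoc (s % (6 * m)) _ _ ⟨
        (s % (6 * m) + q * (6 * m)) + (h ∸ q) * (6 * m)     ≡⟨ cong (_+ (h ∸ q) * (6 * m)) (m≡m%n+[m/n]*n s (6 * m)) ⟨
        s + (h ∸ q) * (6 * m)                               ≡⟨ regroup (unit₆ δ) m u (h ∸ q) ⟩
        (unit₆ δ + 6 * (h ∸ q)) * m + u                     ∎

  -- 114 = 6 · 19 is the larger of the two moduli 6 m.
  threshold : ℕ
  threshold = 2000 * 114

  decomposition : ∀ n → n ≥ threshold → Decomposition n
  decomposition n n≥ with n % 2 ℕ.≟ 0
  ... | yes even = solution⇒decomposition weight₁₉ n n≥ (solve (solution₁₉ (fromℕ< (m%n<n n 114))))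
    where
      to≡ = Fin.toℕ-fromℕ< (m%n<n n 114)
      solve : toℕ (fromℕ< (m%n<n n 114)) % 2 ≡ 1 ⊎ Solution 19 (toℕ (fromℕ< (m%n<n n 114))) → Solution 19 (n % 114)
      solve (inj₂ sol) = subst (Solution 19) to≡ sol
      solve (inj₁ odd) = ⊥-elim (ℕ.0≢1+n (trans (sym even) (trans (sym (m∣n⇒o%n%m≡o%m 2 114 n (divides-refl 57)))
        (trans (cong (_% 2) (sym to≡)) odd))))
  ... | no odd = solution⇒decomposition weight₄ n
      (ℕ.≤-trans (ℕ.*-monoʳ-≤ 2000 {24} {114} (from-yes (24 ℕ.≤? 114))) n≥)
      (solve (solution₄ (fromℕ< (m%n<n n 24))))
    where
      to≡ = Fin.toℕ-fromℕ< (m%n<n n 24)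
      solve : toℕ (fromℕ< (m%n<n n 24)) % 2 ≡ 0 ⊎ Solution 4 (toℕ (fromℕ< (m%n<n n 24))) → Solution 4 (n % 24)
      solve (inj₂ sol) = subst (Solution 4) to≡ sol
      solve (inj₁ even) = ⊥-elim (odd (trans (sym (m∣n⇒o%n%m≡o%m 2 24 n (divides-refl 12)))
        (trans (cong (_% 2) (sym to≡)) even)))

  record FlexibleOA (n : ℕ) : Set where
    field
      array : (Fin 10 → Parity) → OA 5 n
      τ-array : ∀ f g t → let open Triple t in
        τ (array f) t ℙ.+ τ (array g) t ≡ (f (edge c i) ℙ.+ g (edge c i)) ℙ.+ (f (edge c j) ℙ.+ g (edge c j))

  flexibleOA : ∀ n → n ≥ threshold → FlexibleOA n
  flexibleOA n n≥ = subst FlexibleOA (sym n-split) (record { array = F.flexibleOA ; τ-array = F.τ-flexible })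
    where
      open Decomposition (decomposition n n≥)
      w′ = w-10 ε b
      t = unit₆ δ + 6 * a
      hole↔ : Fin (holeOrder ε b) ↔ ((Fin 10 ⊎ Fin w′) × Fin 7)
      hole↔ = ↔-trans (Fin.*↔× {10 + w′} {7}) (Fin.+↔⊎ {10} {w′} ×-↔ ↔-refl)
      t↔ : Fin t ↔ (((Fin 10 ⊎ Fin w′) × Fin 7) ⊎ Fin v)
      t↔ = subst (λ t → Fin t ↔ (((Fin 10 ⊎ Fin w′) × Fin 7) ⊎ Fin v)) (sym t-split)
             (↔-trans (Fin.+↔⊎ {holeOrder ε b} {v}) (hole↔ ⊎-↔ ↔-refl))
      W = relabel (Fin.+↔⊎ {10} {w′}) (linear₅ (10 + w′) (sixInvertible₁₂ ε b))
      T = relabel t↔ (linear₆ t (sixInvertible δ a))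
      iso : (((((Fin 10 ⊎ Fin w′) × Fin 7) ⊎ Fin v) × Fin m) ⊎ ((Fin 10 ⊎ Fin w′) × Fin 7)) ↔ Fin (t * m + holeOrder ε b)
      iso = ↔-sym (↔-trans (Fin.+↔⊎ {t * m} {holeOrder ε b})
              (↔-trans (Fin.*↔× {t} {m}) (t↔ ×-↔ ↔-refl) ⊎-↔ hole↔))
      module F = Flexible W weight T iso

-- Counting the τ-parities.

module Counting where

  open Signs
  open Parities
  open Toggles
  open Existence
  open import Algebra.Solver.Ring.AlmostCommutativeRing using (fromCommutativeRing)
  import Algebra.Solver.Ring.Simple as RingSolver
  open import Data.Empty using (⊥-elim)
  open import Data.Fin.Base using (Fin; zero; suc; _↑ˡ_; splitAt; finToFun; funToFin; combine)
  open import Data.Fin.Patterns using (0F; 1F)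
  open import Data.Fin.Permutation using (_⟨$⟩ʳ_)
  import Data.Fin.Properties as Fin
  open import Data.Fin.Properties using (_≟_; all?)
  open import Data.Nat.Base as ℕ using (ℕ; zero; suc; _≥_)
  open import Data.Parity.Base using (Parity; 0ℙ; 1ℙ; _+_)
  import Data.Parity.Properties as ℙ
  open import Data.Product.Base using (_×_; _,_; proj₁; proj₂)
  open import Data.Product.Properties using (≡-dec)
  open import Data.Sum.Base using (_⊎_; inj₁; inj₂; [_,_]′)
  open import Function.Base using (_∘_; id; const)
  open import Relation.Binary.PropositionalEquality
  open import Relation.Nullary using (Dec; yes; no; ¬?)
  open import Relation.Nullary.Decidable using (_⊎-dec_; _×-dec_; from-yes; map′)
  open RingSolver (fromCommutativeRing ℙ.+-*-commutativeRing) ℙ._≟_ using (solve; _:+_; _:=_)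

  module _ {k l : ℕ} (emb : Fin k → Fin l) (emb-injective : ∀ {i j} → emb i ≡ emb j → i ≡ j) where

    restrict : ∀ {n} → OA l n → OA k n
    restrict A = record
      { entry      = λ r j → OA.entry A r (emb j)
      ; orthogonal = λ i≢j → OA.orthogonal A (i≢j ∘ emb-injective)
      }

    restrictTriple : Triple k → Triple l
    restrictTriple t = record
      { c = emb c ; i = emb i ; j = emb j
      ; c≢i = c≢i ∘ emb-injective ; c≢j = c≢j ∘ emb-injective ; i≢j = i≢j ∘ emb-injective }
      where open Triple t

  module _ {k b : ℕ} (label : Fin (suc (suc k)) → Fin (suc (suc k)) → Fin (suc b))
    (endpoints : Fin (suc b) → Fin (suc (suc k)) × Fin (suc (suc k))) where

    -- A numbering of the edges of the complete graph on the columns, with {0, 1} first; decidable,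
    -- hence checked by evaluation for each k.
    record IsLabelling : Set where
      constructor labelling
      field
        label₀₁         : label 0F 1F ≡ 0F
        label-comm      : ∀ c i → label c i ≡ label i c
        endpoints-label : ∀ c i → c ≡ i ⊎ (endpoints (label c i) ≡ (c , i) ⊎ endpoints (label c i) ≡ (i , c))
        label-endpoints : ∀ x → proj₁ (endpoints x) ≢ proj₂ (endpoints x) ×
                                label (proj₁ (endpoints x)) (proj₂ (endpoints x)) ≡ x

    isLabelling? : Dec IsLabelling
    isLabelling? = map′ (λ (p , q , r , s) → labelling p q r s)
      (λ l → let open IsLabelling l in label₀₁ , label-comm , endpoints-label , label-endpoints)
      ((label 0F 1F ≟ 0F) ×-dec
       ((all? λ c → all? λ i → label c i ≟ label i c) ×-dec
        ((all? λ c → all? λ i → (c ≟ i) ⊎-dec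
           (≡-dec _≟_ _≟_ (endpoints (label c i)) (c , i) ⊎-dec ≡-dec _≟_ _≟_ (endpoints (label c i)) (i , c))) ×-dec
         (all? λ x → ¬? (proj₁ (endpoints x) ≟ proj₂ (endpoints x)) ×-dec
           (label (proj₁ (endpoints x)) (proj₂ (endpoints x)) ≟ x)))))

  parity₂ : Fin 2 → Parity
  parity₂ 0F = 0ℙ
  parity₂ 1F = 1ℙ

  parity₂⁻¹ : Parity → Fin 2
  parity₂⁻¹ 0ℙ = 0F
  parity₂⁻¹ 1ℙ = 1F

  parity₂-parity₂⁻¹ : ∀ p → parity₂ (parity₂⁻¹ p) ≡ p
  parity₂-parity₂⁻¹ 0ℙ = refl
  parity₂-parity₂⁻¹ 1ℙ = refl

  parity₂-injective : ∀ {x y} → parity₂ x ≡ parity₂ y → x ≡ y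
  parity₂-injective {0F} {0F} _ = refl
  parity₂-injective {1F} {1F} _ = refl
  parity₂-injective {0F} {1F} ()
  parity₂-injective {1F} {0F} ()

  funToFin-cong : ∀ {m n} {f g : Fin m → Fin n} → f ≗ g → funToFin f ≡ funToFin g
  funToFin-cong {zero}  f≗g = refl
  funToFin-cong {suc m} f≗g = cong₂ combine (f≗g zero) (funToFin-cong (f≗g ∘ suc))

  finToFun-injective : ∀ {m n} (x y : Fin (n ℕ.^ m)) → finToFun {n} {m} x ≗ finToFun y → x ≡ y
  finToFun-injective {m} {n} x y eq = trans (sym (Fin.funToFin-finToFin {m} {n} x))
    (trans (funToFin-cong {m} {n} eq) (Fin.funToFin-finToFin {m} {n} y))

  -- A function that is zero on the label of {0, 1}: adding a constant to φ leaves τ unchanged.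
  bits : ∀ {b} → Fin (2 ℕ.^ b) → Fin (suc b) → Parity
  bits         x zero    = 0ℙ
  bits {b}     x (suc d) = parity₂ (finToFun {2} {b} x d)

  bits-injective : ∀ {b} (x y : Fin (2 ℕ.^ b)) → bits x ≗ bits y → x ≡ y
  bits-injective {b} x y eq = finToFun-injective {b} {2} x y (parity₂-injective ∘ eq ∘ suc)

  bits⁻¹ : ∀ {b} → (Fin (suc b) → Parity) → Fin (2 ℕ.^ b)
  bits⁻¹ h = funToFin (parity₂⁻¹ ∘ h ∘ suc)

  bits-bits⁻¹ : ∀ {b} (h : Fin (suc b) → Parity) → h zero ≡ 0ℙ → bits (bits⁻¹ h) ≗ h
  bits-bits⁻¹ h h₀ zero    = sym h₀
  bits-bits⁻¹ {b} h h₀ (suc d) = trans (cong parity₂ (Fin.finToFun-funToFin {b} (parity₂⁻¹ ∘ h ∘ suc) d))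
                                       (parity₂-parity₂⁻¹ (h (suc d)))

  -- Edges sharing a column have equal values; from {c, i} one passes to {c, 0} and then to {0, 1}.
  symmetric-constant : ∀ {k} (h : Fin (suc (suc k)) → Fin (suc (suc k)) → Parity) →
    (∀ c i → h c i ≡ h i c) → (∀ {c i j} → c ≢ i → c ≢ j → i ≢ j → h c i ≡ h c j) →
    ∀ {c i} → c ≢ i → h c i ≡ h 0F 1F
  symmetric-constant h h-comm h-star {c} {i} c≢i = from (i ≟ 0F)
    where
      star : ∀ {c i j} → c ≢ i → c ≢ j → h c i ≡ h c j
      star {c} {i} {j} c≢i c≢j with i ≟ j
      ... | yes refl = refl
      ... | no i≢j   = h-star c≢i c≢j i≢j
      through0 : ∀ {x} → x ≢ 0F → h 0F x ≡ h 0F 1F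
      through0 x≢0 = star (x≢0 ∘ sym) (λ ())
      from : Dec (i ≡ 0F) → h c i ≡ h 0F 1F
      from (yes refl) = trans (h-comm c 0F) (through0 c≢i)
      from (no i≢0)   = toZero (c ≟ 0F)
        where
          toZero : Dec (c ≡ 0F) → h c i ≡ h 0F 1F
          toZero (yes refl) = through0 i≢0
          toZero (no c≢0)   = trans (star c≢i c≢0) (trans (h-comm c 0F) (through0 c≢0))

  module Count {k b n : ℕ} {label : Fin (suc (suc k)) → Fin (suc (suc k)) → Fin (suc b)}
    {endpoints : Fin (suc b) → Fin (suc (suc k)) × Fin (suc (suc k))} (isLabelling : IsLabelling label endpoints)
    (A : (Fin (suc b) → Parity) → OA (suc (suc k)) n)
    (τ-A : ∀ f g (t : Triple (suc (suc k))) → τ (A f) t + τ (A g) t ≡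
      (f (label (Triple.c t) (Triple.i t)) + g (label (Triple.c t) (Triple.i t))) +
      (f (label (Triple.c t) (Triple.j t)) + g (label (Triple.c t) (Triple.j t)))) where

    open IsLabelling isLabelling

    private
      -- Equal τ makes f + g constant on all pairs, and the normalisation at {0, 1} makes this
      -- constant zero.
      injective : ∀ f g → f zero ≡ g zero → (∀ t → τ (A f) t ≡ τ (A g) t) → f ≗ g
      injective f g f₀≡g₀ τ≡ x = subst (λ x → f x ≡ g x) (proj₂ (label-endpoints x))
        (+-≡0⇒≡ (trans
          (symmetric-constant h (λ c i → cong (λ x → f x + g x) (label-comm c i)) star (proj₁ (label-endpoints x)))
          (trans (cong (λ x → f x + g x) label₀₁) (trans (cong (_+ g zero) f₀≡g₀) (ℙ.p+p≡0ℙ (g zero))))))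
        where
          h : Fin (suc (suc k)) → Fin (suc (suc k)) → Parity
          h c i = f (label c i) + g (label c i)
          star : ∀ {c i j} → c ≢ i → c ≢ j → i ≢ j → h c i ≡ h c j
          star {c} {i} {j} c≢i c≢j i≢j = +-≡0⇒≡ (trans (sym (τ-A f g t))
            (trans (cong (_+ τ (A g) t) (τ≡ t)) (ℙ.p+p≡0ℙ (τ (A g) t))))
            where t = record { c = c ; i = i ; j = j ; c≢i = c≢i ; c≢j = c≢j ; i≢j = i≢j }

      module _ (B : OA (suc (suc k)) n) where

        -- `G` compares φ of `B` with that of the base array; it is symmetric off the diagonal
        -- because both have the same swap sign. `H` is `G` normalised to vanish at {0, 1}.
        G H : Fin (suc (suc k)) → Fin (suc (suc k)) → Parity
        G c i = φ B c i + φ (A (const 0ℙ)) c i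
        H c i = G c i + G 0F 1F

        G-comm : ∀ {c i} → c ≢ i → G i c ≡ G c i
        G-comm {c} {i} c≢i = trans (cong₂ _+_ (φ-swap B c≢i) (φ-swap (A (const 0ℙ)) c≢i))
          (solve 3 (λ x y s → (x :+ s) :+ (y :+ s) := x :+ y) refl (φ B c i) (φ (A (const 0ℙ)) c i) (sgn (swapₚ n ⟨$⟩ʳ_)))

        target : Fin (suc b) → Parity
        target x = H (proj₁ (endpoints x)) (proj₂ (endpoints x))

        target-label : ∀ {c i} → c ≢ i → target (label c i) ≡ H c i
        target-label {c} {i} c≢i with endpoints-label c i
        ... | inj₁ c≡i       = ⊥-elim (c≢i c≡i)
        ... | inj₂ (inj₁ eq) = cong (λ (c , i) → H c i) eq
        ... | inj₂ (inj₂ eq) = trans (cong (λ (c , i) → H c i) eq) (cong (_+ G 0F 1F) (G-comm c≢i))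

        target₀ : target zero ≡ 0ℙ
        target₀ = trans (cong target (sym label₀₁)) (trans (target-label λ ()) (ℙ.p+p≡0ℙ (G 0F 1F)))

        -- The normalising constant enters for {c, i} and for {c, j}, and so cancels.
        τ-target : ∀ f → f ≗ target → ∀ t → τ (A f) t ≡ τ B t
        τ-target f f≗ t = begin
          τ (A f) t
            ≡⟨ solve 2 (λ x y → x := (x :+ y) :+ y) refl (τ (A f) t) (τ A₀ t) ⟩
          (τ (A f) t + τ A₀ t) + τ A₀ t
            ≡⟨ cong₂ _+_ (τ-A f (const 0ℙ) t) (τ≡φ+φ A₀ t) ⟩
          ((f (label c i) + 0ℙ) + (f (label c j) + 0ℙ)) + (φ A₀ c i + φ A₀ c j)
            ≡⟨ cong (_+ (φ A₀ c i + φ A₀ c j)) (cong₂ _+_ (value c≢i) (value c≢j)) ⟩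
          (H c i + H c j) + (φ A₀ c i + φ A₀ c j)
            ≡⟨ solve 5 (λ x y x′ y′ g → (((x :+ x′) :+ g) :+ ((y :+ y′) :+ g)) :+ (x′ :+ y′) := x :+ y) refl
                 (φ B c i) (φ B c j) (φ A₀ c i) (φ A₀ c j) (G 0F 1F) ⟩
          φ B c i + φ B c j
            ≡⟨ τ≡φ+φ B t ⟨
          τ B t ∎
          where
            open ≡-Reasoning
            open Triple t
            A₀ = A (const 0ℙ)
            value : ∀ {c i} → c ≢ i → f (label c i) + 0ℙ ≡ H c i
            value {c} {i} c≢i = trans (ℙ.+-identityʳ (f (label c i))) (trans (f≗ (label c i)) (target-label c≢i))

    count : 𝓑[ suc (suc k) , n ]≡ b
    count = record
      { to        = λ x → (λ t → τ (A (bits x)) t) , A (bits x) , λ t → refl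
      ; cong      = λ { refl t → refl }
      ; bijective =
          (λ {x} {y} eq → bits-injective x y (injective (bits x) (bits y) refl eq)) ,
          λ (v , B , τB≡v) → bits⁻¹ (target B) , λ { refl t →
            trans (τ-target B (bits (bits⁻¹ (target B))) (bits-bits⁻¹ (target B) (target₀ B)) t) (τB≡v t) }
      }

  truncate : ∀ m {n} → Fin (suc m ℕ.+ n) → Fin (suc m)
  truncate m = [ id , const zero ]′ ∘ splitAt (suc m)

  -- The pairs of the first k columns are the first k C 2 of the ten pairs; the maps ↓
  -- only matter on these columns and pairs.
  module Prefix (k b : ℕ)
    (column↑ : Fin (suc (suc k)) → Fin 5) (column↑-injective : ∀ {i j} → column↑ i ≡ column↑ j → i ≡ j)
    (column↓ : Fin 5 → Fin (suc (suc k)))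
    (pair↑ : Fin (suc b) → Fin 10) (pair↓ : Fin 10 → Fin (suc b)) where

    label : Fin (suc (suc k)) → Fin (suc (suc k)) → Fin (suc b)
    label c i = pair↓ (edge (column↑ c) (column↑ i))

    endpoints : Fin (suc b) → Fin (suc (suc k)) × Fin (suc (suc k))
    endpoints x = column↓ (proj₁ (ends (pair↑ x))) , column↓ (proj₂ (ends (pair↑ x)))

    prefix-count : IsLabelling label endpoints → ∀ n → n ≥ threshold → 𝓑[ suc (suc k) , n ]≡ b
    prefix-count isLabelling n n≥ = Count.count isLabelling
      -- Pairs beyond the first columns get the junk value h 0, which the restricted array does not
      -- see.
      (λ h → restrict column↑ column↑-injective (array (h ∘ pair↓)))
      -- τ of a restricted array is by definition τ of the full array at the embedded triple.
      (λ f g t → τ-array (f ∘ pair↓) (g ∘ pair↓) (restrictTriple column↑ column↑-injective t))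
      where open FlexibleOA (flexibleOA n n≥)

  module Prefix₃ = Prefix 1 2 (_↑ˡ 2) (Fin.↑ˡ-injective 2 _ _) (truncate 2) (_↑ˡ 7) (truncate 2)
  module Prefix₄ = Prefix 2 5 (_↑ˡ 1) (Fin.↑ˡ-injective 1 _ _) (truncate 3) (_↑ˡ 4) (truncate 5)
  module Prefix₅ = Prefix 3 9 id id id id id

  count₃ : ∀ n → n ≥ threshold → 𝓑[ 3 , n ]≡ 2
  count₃ = Prefix₃.prefix-count (from-yes (isLabelling? Prefix₃.label Prefix₃.endpoints))

  count₄ : ∀ n → n ≥ threshold → 𝓑[ 4 , n ]≡ 5
  count₄ = Prefix₄.prefix-count (from-yes (isLabelling? Prefix₄.label Prefix₄.endpoints))

  count₅ : ∀ n → n ≥ threshold → 𝓑[ 5 , n ]≡ 9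
  count₅ = Prefix₅.prefix-count (from-yes (isLabelling? Prefix₅.label Prefix₅.endpoints))

open Existence using (threshold)
open Counting using (count₃; count₄; count₅)

mainTheorem4 : (k : ℕ) → k ≡ 3 ⊎ k ≡ 4 ⊎ k ≡ 5 →
    ∃[ N₀ ] ((n : ℕ) → n ≥ N₀ → 𝓑[ k , n ]≡ (k C 2 ∸ 1))
mainTheorem4 _ (inj₁ refl)        = threshold , count₃
mainTheorem4 _ (inj₂ (inj₁ refl)) = threshold , count₄
mainTheorem4 _ (inj₂ (inj₂ refl)) = threshold , count₅
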